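{- Every class of graphs with low twin-width covers is weakly $\chi_p$-bounded for every positive integer $p$.
   Context: All graphs are finite, simple and undirected. Twin-width: a trigraph has a vertex set and two disjoint sets of edges, black and red. Contracting two (not necessarily adjacent) vertices $u,v$ of a trigraph replaces them by a new vertex $w$; for every other vertex $x$, the edge $wx$ is black if both $ux$ and $vx$ are black edges, absent if $x$ is adjacent (by any edge) to neither $u$ nor $v$, and red otherwise; all other edges are unchanged. The twin-width of a graph $G$ is the least $d$ such that there is a sequence of contractions from $G$ (all edges black) to a one-vertex graph in which every trigraph has red degree at most $d$ at every vertex. A class $\mathscr C$ has low twin-width covers if for every positive integer $p$ there are a constant $C_p$ and an integer $n_p$ such that for every $G\in\mathscr C$ there is a family $\mathcal F$ of at most $n_p$ subsets of $V(G)$ such that every set of at most $p$ vertices of $G$ is included in some member of $\mathcal F$, and every member of $\mathcal F$ induces a subgraph of $G$ of twin-width at most $C_p$. $\omega$ is the clique number; for a class $\mathscr D$, $\omega(\mathscr D)=\sup_{G\in\mathscr D}\omega(G)$. ${\rm TM}_r(G)$ is the class of all graphs $H$ such that some graph obtained from $H$ by subdividing each edge by at most $r$ vertices is a subgraph of $G$. The tree-depth ${\rm td}(G)$ is the minimum height (number of vertices on a longest root-to-leaf path) of a rooted forest $Y$ such that $G$ is a subgraph of the closure of $Y$ (the graph in which each vertex is adjacent to all its ancestors in $Y$). $\chi_p(G)$ is the minimum number of colors in a vertex coloring of $G$ such that every set $I$ of at most $p$ colors induces a subgraph of tree-depth at most $|I|$. A class $\mathscr C$ is weakly $\chi_p$-bounded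 if there is a function $g_p$ with $\chi_p(G)\leq g_p(\omega({\rm TM}_{p-1}(G)))$ for every $G\in\mathscr C$. -}

module Defs where

open import Data.Bool using (Bool; true; false; T; if_then_else_)
open import Data.Fin using (Fin; toℕ; punchIn; _<_; _≟_)
open import Data.Fin.Subset using (Subset; _∈_; _⊆_; ∣_∣)
open import Data.Fin.Subset.Properties using (_∈?_)
open import Data.List as List using (List; length; filter; allFin; foldr)
open import Data.List.Relation.Unary.All using (All)
open import Data.List.Relation.Unary.Any using (Any)
open import Data.Maybe using (Maybe; just; nothing)
open import Data.Nat using (ℕ; suc; pred; _≤_; _⊔_; NonZero)
open import Data.Product using (Σ; ∃-syntax; _×_; proj₁)
import Data.Vec as Vec
open import Function using (_∘_)
open import Function.Definitions using (Injective)
open import Level using (Level; 0ℓ)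
open import Relation.Binary using (Rel; _=[_]⇒_)
open import Relation.Binary.Construct.Closure.Symmetric using (SymClosure)
open import Relation.Binary.Construct.Closure.Transitive using (TransClosure)
open import Relation.Binary.PropositionalEquality using (_≡_; _≢_; refl; cong)
open import Relation.Nullary using (yes; no)
open import Relation.Unary using (Pred)

private variable
  ℓ : Level
  n : ℕ

-- A parameter defined as a minimum or maximum is given by the predicate
-- "the value of the parameter is k".

IsMinimum : Pred ℕ ℓ → Pred ℕ ℓ
IsMinimum P k = P k × (∀ j → P j → k ≤ j)

IsMaximum : Pred ℕ ℓ → Pred ℕ ℓ
IsMaximum P k = P k × (∀ j → P j → j ≤ k)

-- If IsValue expresses "the parameter equals _", this is "the parameter
-- is at most b".

infix 4 _AtMost_

_AtMost_ : Pred ℕ ℓ → Pred ℕ ℓ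
IsValue AtMost b = ∃[ k ] IsValue k × k ≤ b

record Graph : Set where
  field
    order      : ℕ
    adj        : Fin order → Fin order → Bool
    adj-sym    : ∀ u v → adj u v ≡ adj v u
    adj-irrefl : ∀ v → adj v v ≡ false

  Vertex : Set
  Vertex = Fin order

  Adjacent : Rel Vertex 0ℓ
  Adjacent u v = T (adj u v)

open Graph public using (order; Vertex; Adjacent)

-- Being a (not necessarily induced) subgraph, up to isomorphism; graphs
-- on either side are represented by their adjacency relations.

IsSubgraph : {A B : Set} → Rel A 0ℓ → Rel B 0ℓ → Set
IsSubgraph {A} {B} E F =
  Σ (A → B) λ f → Injective _≡_ _≡_ f × (E =[ f ]⇒ F)

members : Subset n → List (Fin n)
members {n} X = filter (_∈? X) (allFin n)

-- The subgraph induced by X: its i-th vertex is the i-th element of X.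

induced : (G : Graph) → Subset (order G) → Graph
induced G X = record
  { order      = length (members X)
  ; adj        = λ i j → Graph.adj G (vertex i) (vertex j)
  ; adj-sym    = λ i j → Graph.adj-sym G (vertex i) (vertex j)
  ; adj-irrefl = λ i → Graph.adj-irrefl G (vertex i)
  }
  where
  vertex : Fin (length (members X)) → Vertex G
  vertex = List.lookup (members X)

data EdgeType : Set where
  none black red : EdgeType

isRed : EdgeType → Bool
isRed red = true
isRed _   = false

record Trigraph (n : ℕ) : Set where
  field
    edge        : Fin n → Fin n → EdgeType
    edge-sym    : ∀ u v → edge u v ≡ edge v u
    edge-irrefl : ∀ v → edge v v ≡ none

open Trigraph public using (edge)

fromGraph : (G : Graph) → Trigraph (order G)
fromGraph G = record
  { edge        = λ u v → colour (Graph.adj G u v)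
  ; edge-sym    = λ u v → cong colour (Graph.adj-sym G u v)
  ; edge-irrefl = λ v → cong colour (Graph.adj-irrefl G v)
  }
  where
  colour : Bool → EdgeType
  colour b = if b then black else none

redDegree : Trigraph n → Fin n → ℕ
redDegree t v = ∣ Vec.tabulate (λ x → isRed (edge t v x)) ∣

merge : EdgeType → EdgeType → EdgeType
merge black black = black
merge none  none  = none
merge _     _     = red

-- Contracting u and v, for u ≢ v: the vertex v is deleted, punchIn v
-- embeds the remaining vertices into the old ones, and the vertex
-- embedded as u plays the role of the new vertex w.

contract : Trigraph (suc n) → (u v : Fin (suc n)) → Trigraph n
contract {n} t u v = record
  { edge        = λ x y → edge′ (punchIn v x) (punchIn v y)
  ; edge-sym    = λ x y → edge′-sym (punchIn v x) (punchIn v y)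
  ; edge-irrefl = λ x → edge′-irrefl (punchIn v x)
  }
  where
  edge′ : Fin (suc n) → Fin (suc n) → EdgeType
  edge′ x y with x ≟ u | y ≟ u
  ... | yes _ | yes _ = none
  ... | yes _ | no  _ = merge (edge t u y) (edge t v y)
  ... | no  _ | yes _ = merge (edge t u x) (edge t v x)
  ... | no  _ | no  _ = edge t x y

  edge′-sym : ∀ x y → edge′ x y ≡ edge′ y x
  edge′-sym x y with x ≟ u | y ≟ u
  ... | yes _ | yes _ = refl
  ... | yes _ | no  _ = refl
  ... | no  _ | yes _ = refl
  ... | no  _ | no  _ = Trigraph.edge-sym t x y

  edge′-irrefl : ∀ x → edge′ x x ≡ none
  edge′-irrefl x with x ≟ u
  ... | yes _ = refl
  ... | no  _ = Trigraph.edge-irrefl t x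

-- Contraction sequences in which all red degrees are at most d. The
-- empty graph needs no contraction, so it gets twin-width 0.

data ContractionSequence (d : ℕ) : Trigraph n → Set where
  stop : {t : Trigraph n} → n ≤ 1 →
         (∀ x → redDegree t x ≤ d) →
         ContractionSequence d t
  step : {t : Trigraph (suc n)} →
         (∀ x → redDegree t x ≤ d) →
         (u v : Fin (suc n)) → u ≢ v →
         ContractionSequence d (contract t u v) →
         ContractionSequence d t

IsTwinWidth : Graph → Pred ℕ 0ℓ
IsTwinWidth G = IsMinimum (λ d → ContractionSequence d (fromGraph G))

LowTwinWidthCovers : Pred Graph ℓ → Set ℓ
LowTwinWidthCovers 𝒞 =
  ∀ p → .{{NonZero p}} →
  ∃[ C ] ∃[ N ] ∀ G → 𝒞 G →
  Σ (List (Subset (order G))) λ F →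
    length F ≤ N ×
    (∀ X → ∣ X ∣ ≤ p → Any (X ⊆_) F) ×
    All (λ Y → IsTwinWidth (induced G Y) AtMost C) F

IsClique : (G : Graph) → Subset (order G) → Set
IsClique G X = ∀ {u v} → u ∈ X → v ∈ X → u ≢ v → Adjacent G u v

IsCliqueNumber : Graph → Pred ℕ 0ℓ
IsCliqueNumber G = IsMaximum (λ k → ∃[ X ] IsClique G X × ∣ X ∣ ≡ k)

-- The supremum of the clique numbers of the members of 𝒟 (no value if
-- these are unbounded).

IsClassCliqueNumber : Pred Graph 0ℓ → Pred ℕ 0ℓ
IsClassCliqueNumber 𝒟 =
  IsMinimum (λ b → ∀ H → 𝒟 H → ∀ k → IsCliqueNumber H k → k ≤ b)

-- Each edge is represented once, oriented from its smaller endpoint.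

record Edge (H : Graph) : Set where
  constructor mkEdge
  field
    source target : Vertex H
    ordered       : source < target
    adjacent      : Adjacent H source target

open Edge public using (source; target)

-- SubVertex and SubAdjacent form the graph obtained from H by
-- subdividing each edge e by s e vertices.

module Subdivision (H : Graph) (s : Edge H → ℕ) where

  data SubVertex : Set where
    original    : Vertex H → SubVertex
    subdividing : (e : Edge H) → Fin (s e) → SubVertex

  data Link : Rel SubVertex 0ℓ where
    whole : ∀ e → s e ≡ 0 →
            Link (original (source e)) (original (target e))
    first : ∀ e i → toℕ i ≡ 0 →
            Link (original (source e)) (subdividing e i)
    next  : ∀ e i j → toℕ j ≡ suc (toℕ i) →
            Link (subdividing e i) (subdividing e j)
    last  : ∀ e i → suc (toℕ i) ≡ s e →
            Link (subdividing e i) (original (target e))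

  SubAdjacent : Rel SubVertex 0ℓ
  SubAdjacent = SymClosure Link

open Subdivision public using (SubAdjacent)

TM : ℕ → Graph → Pred Graph 0ℓ
TM r G H = Σ (Edge H → ℕ) λ s →
  (∀ e → s e ≤ r) × IsSubgraph (SubAdjacent H s) (Adjacent G)

-- In Depth parent v d, d is the number of vertices on the path from v up
-- to the root above it.

data Depth (parent : Fin n → Maybe (Fin n)) : Fin n → ℕ → Set where
  root  : ∀ {v} → parent v ≡ nothing → Depth parent v 1
  child : ∀ {u v d} → parent v ≡ just u → Depth parent u d →
          Depth parent v (suc d)

record Forest : Set where
  field
    size   : ℕ
    parent : Fin size → Maybe (Fin size)
    rooted : ∀ v → ∃[ d ] Depth parent v d

  height : ℕ
  height = foldr _⊔_ 0 (List.tabulate (proj₁ ∘ rooted))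

  IsParent : Rel (Fin size) 0ℓ
  IsParent u v = parent v ≡ just u

  IsAncestor : Rel (Fin size) 0ℓ
  IsAncestor = TransClosure IsParent

  Closure : Rel (Fin size) 0ℓ
  Closure = SymClosure IsAncestor

open Forest public using (height; Closure)

IsTreeDepth : Graph → Pred ℕ 0ℓ
IsTreeDepth G =
  IsMinimum (λ h → ∃[ Y ] height Y ≡ h × IsSubgraph (Adjacent G) (Closure Y))

preimage : {k : ℕ} → (Fin n → Fin k) → Subset k → Subset n
preimage c I = Vec.tabulate (λ v → Vec.lookup I (c v))

LowTreeDepthColouring : ℕ → (G : Graph) (k : ℕ) → (Vertex G → Fin k) → Set
LowTreeDepthColouring p G k c =
  ∀ I → ∣ I ∣ ≤ p → IsTreeDepth (induced G (preimage c I)) AtMost ∣ I ∣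

Isχ : ℕ → Graph → Pred ℕ 0ℓ
Isχ p G = IsMinimum (λ k → ∃[ c ] LowTreeDepthColouring p G k c)

-- Isχ p G and the clique number of the class are single-valued, so the
-- inequality between the two parameters is stated for their values c, w.

Weaklyχ-Bounded : ℕ → Pred Graph ℓ → Set ℓ
Weaklyχ-Bounded p 𝒞 =
  Σ (ℕ → ℕ) λ g → ∀ G → 𝒞 G →
  ∀ w c → IsClassCliqueNumber (TM (pred p) G) w → Isχ p G c → c ≤ g w

{-# OPTIONS --safe #-}
module Submission where

open import Data.Bool using (true; false; not; if_then_else_)
open import Data.Bool.Properties using (T-irrelevant)
open import Data.Empty using (⊥-elim)
open import Data.Fin as Fin using
  (Fin; zero; suc; toℕ; fromℕ<; inject≤; punchIn; punchOut; combine; finToFun; funToFin)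
import Data.Fin.Properties as Fin
open import Data.Fin.Subset using (Subset; _∈_; _⊆_; ∣_∣; _-_; _∩_; ⊤; ⊥)
open import Data.Fin.Subset.Properties using
  (_∈?_; ∈⊤; ∣⊤∣≡n; ∣⊥∣≡0; ∣p∣≤n; x∈p⇒∣p-x∣<∣p∣; x∈p∧x≢y⇒x∈p-y; x∈p∩q⁺; x∈p∩q⁻)
open import Data.List as List using
  (List; []; _∷_; _++_; length; filter; foldr; allFin; concatMap)
open import Data.List.Membership.DecPropositional using () renaming (_∈?_ to mem?)
open import Data.List.Membership.Propositional using () renaming (_∈_ to _∈ˡ_; _∉_ to _∉ˡ_)
open import Data.List.Membership.Propositional.Properties using
  (∈-++⁺ˡ; ∈-++⁺ʳ; ∈-allFin; ∈-filter⁺; ∈-filter⁻; ∈-lookup; ∈-map⁺)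
open import Data.List.Properties using (length-++; length-map)
open import Data.List.Relation.Unary.All as All using (All)
open import Data.List.Relation.Unary.AllPairs using (_∷_)
open import Data.List.Relation.Unary.Any as Any using (Any; here; there)
open import Data.List.Relation.Unary.Any.Properties using (lookup-index)
open import Data.List.Relation.Unary.Unique.Propositional using (Unique)
import Data.List.Relation.Unary.Unique.Propositional.Properties as Unique
open import Data.Maybe using (Maybe; just; nothing)
open import Data.Maybe.Properties using (just-injective)
open import Data.Nat
open import Data.Nat.Induction using (<-rec)
open import Data.Nat.Properties
open import Data.Product using (Σ; ∃-syntax; _×_; _,_; proj₁; proj₂; map₂)
open import Data.Sum using (_⊎_; inj₁; inj₂)
open import Data.Unit using (tt)
open import Data.Vec as Vec using ([]; _∷_)
open import Data.Vec.Properties using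
  ([]=⇒lookup; lookup⇒[]=; lookup∘tabulate; []≔-updates; []≔-minimal)
open import Function using (_∘_; id; case_of_)
open import Function.Definitions using (Injective)
open import Level using (Level; 0ℓ)
open import Relation.Binary using (Rel; Symmetric; tri<; tri≈; tri>)
open import Relation.Binary.Construct.Closure.Symmetric using (fwd; bwd)
open import Relation.Binary.Construct.Closure.Transitive as Transitive using ([_])
open import Relation.Binary.PropositionalEquality hiding (J; [_])
open import Relation.Nullary
open import Relation.Nullary.Decidable using (decidable-stable; dec-true; ¬¬-excluded-middle)
open import Relation.Unary using (Pred; Decidable)

open import Defs

-- If every p vertices of G lie in one of N pieces, the product of suitable
-- colourings of the pieces works for G: the vertices seeing at most p
-- product colours all lie in one piece.  In a piece, a colouring works if
-- for some vertex order a walk with at most p colours ending at its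
-- minimum never starts at another vertex of the same colour: taking
-- minima of components as roots gives an elimination forest.  For p = 1 such colourings exist because bounded
-- twin-width implies χ-boundedness.  For p ≥ 2 the bound on topological
-- minors excludes a biclique K_{s,s}; ordering the vertices by the time
-- at which their parts in the contraction sequence reach size s bounds
-- the number of vertices weakly reachable from a vertex by short walks,
-- and it suffices to colour greedily along this order.

-- Walks have unbounded length, so neither ancestry in the elimination forest nor the exact
-- tree-depth is decided outright; both are obtained under double negation. Nothing is lost, because
-- the final claim is an inequality of natural numbers and hence stable.
--
-- The pieces need no common vertex order: each set of few product colours is treated inside one
-- piece, with the order of that piece.
--
-- Few colours do not bound the length of a walk, while reachability arguments handle only short
-- walks. The gap is closed by shortening a walk with at most p colours to length at most 2^(p+1) -
-- 2.
--
-- Both uses of a contraction sequence watch when a property of parts first holds: having at least s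
-- vertices for p at least 2, having no black neighbour that meets a given set for p = 1. They share
-- one construction. For the first property the delicate case is that of vertices acquiring it in
-- the same contraction; they lie in the two contracted parts, which bounds their number.

private variable
  ℓ : Level
  d k l m n p w : ℕ
  A B : Set

-- Double negation

¬¬-Fin : {P : Fin n → Set ℓ} → (∀ i → ¬ ¬ P i) → ¬ ¬ (∀ i → P i)
¬¬-Fin {n = zero}  _ ¬P = ¬P λ ()
¬¬-Fin {n = suc n} h ¬P =
  h zero λ p₀ → ¬¬-Fin (h ∘ suc) λ ps → ¬P λ { zero → p₀ ; (suc i) → ps i }

¬¬-Subset : {P : Subset n → Set ℓ} → (∀ X → ¬ ¬ P X) → ¬ ¬ (∀ X → P X)
¬¬-Subset {n = zero}  h ¬P = h [] λ p₀ → ¬P λ { [] → p₀ }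
¬¬-Subset {n = suc n} h ¬P =
  ¬¬-Subset (h ∘ (true ∷_)) λ ps → ¬¬-Subset (h ∘ (false ∷_)) λ qs →
  ¬P λ { (true ∷ X) → ps X ; (false ∷ X) → qs X }

-- `P` carries no decision procedure, so the descent to a least value ends only under double
-- negation.
¬¬-minimum : {P : Pred ℕ ℓ} → ∀ k → P k → ¬ ¬ (IsMinimum P AtMost k)
¬¬-minimum {P = P} = <-rec _ λ k below Pk ¬min →
  ¬min (k , (Pk , λ j Pj → ≮⇒≥ λ j<k →
    below j<k Pj λ { (i , min , i≤j) → ¬min (i , min , ≤-trans i≤j (<⇒≤ j<k)) }) , ≤-refl)

greatest : {P : Fin n → Set} (ρ : Fin n → ℕ) → (∀ u → Dec (P u)) →
           (∀ u → ¬ P u) ⊎ (∃[ u ] P u × ∀ w → P w → ρ w ≤ ρ u)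
greatest {n = zero}  ρ P? = inj₁ λ ()
greatest {n = suc n} ρ P? with P? zero | greatest (ρ ∘ suc) (P? ∘ suc)
... | no ¬p₀ | inj₁ ¬P = inj₁ λ { zero → ¬p₀ ; (suc u) → ¬P u }
... | no ¬p₀ | inj₂ (u , Pu , max) =
  inj₂ (suc u , Pu , λ { zero → ⊥-elim ∘ ¬p₀ ; (suc w) → max w })
... | yes p₀ | inj₁ ¬P =
  inj₂ (zero , p₀ , λ { zero _ → ≤-refl ; (suc w) → ⊥-elim ∘ ¬P w })
... | yes p₀ | inj₂ (u , Pu , max) with ≤-total (ρ (suc u)) (ρ zero)
...   | inj₁ u≤0 =
  inj₂ (zero , p₀ , λ { zero _ → ≤-refl ; (suc w) Pw → ≤-trans (max w Pw) u≤0 })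
...   | inj₂ 0≤u = inj₂ (suc u , Pu , λ { zero _ → 0≤u ; (suc w) → max w })

-- Walks

data Walk {A : Set} (E : Rel A 0ℓ) (P : Pred A 0ℓ) : ℕ → Rel A 0ℓ where
  here : ∀ {a} → P a → Walk E P 0 a a
  step : ∀ {a b c} → P a → E a b → Walk E P k b c → Walk E P (suc k) a c

module _ {E : Rel A 0ℓ} {P : Pred A 0ℓ} where

  walk-start : ∀ {a b} → Walk E P k a b → P a
  walk-start (here Pa)     = Pa
  walk-start (step Pa _ _) = Pa

  walk-++ : ∀ {a b c} → Walk E P k a b → Walk E P l b c → Walk E P (k + l) a c
  walk-++ (here _)      w = w
  walk-++ (step Pa e v) w = step Pa e (walk-++ v w)

  walk-snoc : ∀ {a b c} → Walk E P k a b → E b c → P c → Walk E P (suc k) a c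
  walk-snoc (here Pa)      e Pc = step Pa e (here Pc)
  walk-snoc (step Pa e′ w) e Pc = step Pa e′ (walk-snoc w e Pc)

  walk-reverse : Symmetric E → ∀ {a b} → Walk E P k a b → Walk E P k b a
  walk-reverse E-sym (here Pa)     = here Pa
  walk-reverse E-sym (step Pa e w) = walk-snoc (walk-reverse E-sym w) (E-sym e) Pa

walk-map : {E : Rel A 0ℓ} {F : Rel B 0ℓ} {P : Pred A 0ℓ} {Q : Pred B 0ℓ}
           (f : A → B) → (∀ {x y} → E x y → F (f x) (f y)) → (∀ {x} → P x → Q (f x)) →
           ∀ {a b} → Walk E P k a b → Walk F Q k (f a) (f b)
walk-map f hom P⇒Q (here Pa)     = here (P⇒Q Pa)
walk-map f hom P⇒Q (step Pa e w) = step (P⇒Q Pa) (hom e) (walk-map f hom P⇒Q w)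

walk-weaken : {E : Rel A 0ℓ} {P Q : Pred A 0ℓ} → (∀ {x} → P x → Q x) →
              ∀ {a b} → Walk E P k a b → Walk E Q k a b
walk-weaken = walk-map id id

Adjacent-sym : (G : Graph) → Symmetric (Adjacent G)
Adjacent-sym G {u} {v} rewrite Graph.adj-sym G u v = id

Adjacent-irrefl : (G : Graph) → ∀ {u v} → Adjacent G u v → u ≢ v
Adjacent-irrefl G {u} uv refl rewrite Graph.adj-irrefl G u = uv

-- An ordered form of p-centred colourings: in a connected subgraph with at most `p` colours, the
-- colour of the `ρ`-minimum occurs only there.
Centred : ℕ → (G : Graph) → (Vertex G → ℕ) → (Vertex G → Fin k) → Set
Centred p G ρ c = ∀ J → ∣ J ∣ ≤ p → ∀ {u v l} →
  Walk (Adjacent G) (λ x → ρ u ≤ ρ x × c x ∈ J) l v u → c u ≡ c v → u ≡ v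

CentredColouring : ℕ → Graph → ℕ → Set
CentredColouring p G k =
  Σ (Vertex G → ℕ) λ ρ → Injective _≡_ _≡_ ρ × Σ (Vertex G → Fin k) (Centred p G ρ)

-- Elimination forests

module EliminationForest
  (G : Graph) (ρ : Vertex G → ℕ) (ρ-inj : Injective _≡_ _≡_ ρ)
  (c : Vertex G → Fin k) (centre : ∀ {u v l} →
     Walk (Adjacent G) (λ x → ρ u ≤ ρ x) l v u → c u ≡ c v → u ≡ v)
  where

  Ancestor : Rel (Vertex G) 0ℓ
  Ancestor u v = u ≢ v × ∃[ l ] Walk (Adjacent G) (λ x → ρ u ≤ ρ x) l v u

  ancestor-< : ∀ {u v} → Ancestor u v → ρ u < ρ v
  ancestor-< (u≢v , _ , w) = ≤∧≢⇒< (walk-start w) (u≢v ∘ ρ-inj)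

  ancestor-trans : ∀ {u v w} → Ancestor u v → Ancestor v w → Ancestor u w
  ancestor-trans {u} {v} {w} uv@(_ , _ , p) vw@(_ , _ , q) =
    (λ { refl → <-asym (ancestor-< uv) (ancestor-< vw) }) , _ ,
    walk-++ (walk-weaken (≤-trans (<⇒≤ (ancestor-< uv))) q) p

  -- The walks to `u` and `v` are joined at `w`. Hence the ancestors of a vertex form a chain, which
  -- is what makes `Ancestor` the order of a forest.
  ancestor-chain : ∀ {u v w} → Ancestor u w → Ancestor v w → ρ u < ρ v → Ancestor u v
  ancestor-chain (_ , _ , p) (_ , _ , q) u<v =
    (λ { refl → <-irrefl refl u<v }) , _ ,
    walk-++ (walk-reverse (Adjacent-sym G) (walk-weaken (≤-trans (<⇒≤ u<v)) q)) p

  adjacent⇒ancestor : ∀ {u v} → Adjacent G u v → ρ u < ρ v → Ancestor u v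
  adjacent⇒ancestor uv u<v =
    Adjacent-irrefl G uv , 1 , step (<⇒≤ u<v) (Adjacent-sym G uv) (here ≤-refl)

  LastAncestor : Vertex G → Set
  LastAncestor v = (∀ u → ¬ Ancestor u v) ⊎
                   (∃[ u ] Ancestor u v × ∀ w → Ancestor w v → ρ w ≤ ρ u)

  -- Excluded middle for each pair of vertices replaces a search over walks of unbounded length;
  -- there are finitely many pairs, so the double negations combine.
  ¬¬-lastAncestor : ¬ ¬ (∀ v → LastAncestor v)
  ¬¬-lastAncestor = ¬¬-Fin λ v ¬last →
    ¬¬-Fin (λ u → ¬¬-excluded-middle) (¬last ∘ greatest ρ)

  module _ (last : ∀ v → LastAncestor v) where

    forestParent : Vertex G → Maybe (Vertex G)
    forestParent v with last v
    ... | inj₁ _       = nothing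
    ... | inj₂ (u , _) = just u

    parent⇒ancestor : ∀ {u v} → forestParent v ≡ just u → Ancestor u v
    parent⇒ancestor {v = v} eq with last v
    parent⇒ancestor refl | inj₂ (_ , anc , _) = anc

    rooted-below : ∀ b v → ρ v < b → ∃[ d ] Depth forestParent v d
    rooted-below (suc b) v (s≤s v≤b) with forestParent v in eq
    ... | nothing = 1 , root eq
    ... | just u  with rooted-below b u (≤-trans (ancestor-< (parent⇒ancestor eq)) v≤b)
    ...   | d , depth = suc d , child eq depth

    forest : Forest
    forest = record
      { size   = order G
      ; parent = forestParent
      ; rooted = λ v → rooted-below _ v ≤-refl
      }

    ancestor⇒forest : ∀ b {u v} → ρ v < b → Ancestor u v → Forest.IsAncestor forest u v
    ancestor⇒forest (suc b) {u} {v} (s≤s v≤b) uv with last v in eq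
    ... | inj₁ ¬P = ⊥-elim (¬P u uv)
    ... | inj₂ (w , wv , max) with u Fin.≟ w
    ...   | yes refl = [ parent≡ ]
      where
      parent≡ : forestParent v ≡ just w
      parent≡ rewrite eq = refl
    ...   | no u≢w = ancestor⇒forest b (≤-trans (ancestor-< wv) v≤b)
                       (ancestor-chain uv wv (≤∧≢⇒< (max u uv) (u≢w ∘ ρ-inj)))
                     Transitive.∷ʳ parent≡
      where
      parent≡ : forestParent v ≡ just w
      parent≡ rewrite eq = refl

    adjacent⇒closure : ∀ {u v} → Adjacent G u v → Closure forest u v
    adjacent⇒closure {u} {v} uv with <-cmp (ρ u) (ρ v)
    ... | tri< u<v _ _ = fwd (ancestor⇒forest _ ≤-refl (adjacent⇒ancestor uv u<v))
    ... | tri≈ _ u≡v _ = ⊥-elim (Adjacent-irrefl G uv (ρ-inj u≡v))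
    ... | tri> _ _ v<u =
      bwd (ancestor⇒forest _ ≤-refl (adjacent⇒ancestor (Adjacent-sym G uv) v<u))

    -- By `centre` no proper ancestor of `v` repeats its colour, so each step towards the root
    -- removes a colour from `J`.
    depth-bound : ∀ {v d} → Depth forestParent v d → (J : Subset k) → c v ∈ J →
                  (∀ {u} → Ancestor u v → c u ∈ J) → d ≤ ∣ J ∣
    depth-bound (root _) J v∈J _ = ≤-trans (s≤s z≤n) (x∈p⇒∣p-x∣<∣p∣ v∈J)
    depth-bound {v} (child {u} eq depth) J v∈J anc∈J =
      <-≤-trans (s≤s (depth-bound depth (J - c v) (keep uv) λ wu → keep (ancestor-trans wu uv)))
                (x∈p⇒∣p-x∣<∣p∣ v∈J)
      where
      uv : Ancestor u v
      uv = parent⇒ancestor eq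

      keep : ∀ {w} → Ancestor w v → c w ∈ J - c v
      keep wv@(w≢v , _ , walk) = x∈p∧x≢y⇒x∈p-y (anc∈J wv) (w≢v ∘ centre walk)

foldr-⊔-≤ : ∀ {b} {n} (f : Fin n → ℕ) → (∀ i → f i ≤ b) → foldr _⊔_ 0 (List.tabulate f) ≤ b
foldr-⊔-≤ {n = zero}  f f≤b = z≤n
foldr-⊔-≤ {n = suc n} f f≤b = ⊔-lub (f≤b zero) (foldr-⊔-≤ (f ∘ suc) (f≤b ∘ suc))

treeDepth-bound :
  (G : Graph) (ρ : Vertex G → ℕ) → Injective _≡_ _≡_ ρ → (c : Vertex G → Fin k) →
  (∀ {u v l} → Walk (Adjacent G) (λ x → ρ u ≤ ρ x) l v u → c u ≡ c v → u ≡ v) →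
  (J : Subset k) → (∀ v → c v ∈ J) → ¬ ¬ (IsTreeDepth G AtMost ∣ J ∣)
treeDepth-bound G ρ ρ-inj c centre J c∈J ¬td = F.¬¬-lastAncestor λ last →
  let Y = F.forest last
      h≤ : height Y ≤ ∣ J ∣
      h≤ = foldr-⊔-≤ _ λ v →
             F.depth-bound last (proj₂ (Forest.rooted Y v)) J (c∈J v) (λ _ → c∈J _)
  in ¬¬-minimum (height Y) (Y , refl , id , (λ {_} {_} eq → eq) ,
                               λ {_} {_} → F.adjacent⇒closure last) λ where
       (i , min , i≤h) → ¬td (i , min , ≤-trans i≤h h≤)
  where module F = EliminationForest G ρ ρ-inj c centre

-- Covers and products of colourings

lookup-injective : {xs : List A} → Unique xs → ∀ {i j} →
                   List.lookup xs i ≡ List.lookup xs j → i ≡ j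
lookup-injective (_ ∷ _)   {zero}  {zero}  _  = refl
lookup-injective (x∉ ∷ _)  {zero}  {suc j} eq = ⊥-elim (All.lookup x∉ (∈-lookup j) eq)
lookup-injective (x∉ ∷ _)  {suc i} {zero}  eq = ⊥-elim (All.lookup x∉ (∈-lookup i) (sym eq))
lookup-injective (_ ∷ uniq) {suc i} {suc j} eq = cong suc (lookup-injective uniq eq)

∣insert∣ : ∀ (x : Fin n) X → ∣ X Vec.[ x ]≔ true ∣ ≤ suc ∣ X ∣
∣insert∣ zero    (true ∷ X)  = n≤1+n _
∣insert∣ zero    (false ∷ X) = ≤-refl
∣insert∣ (suc x) (true ∷ X)  = s≤s (∣insert∣ x X)
∣insert∣ (suc x) (false ∷ X) = ∣insert∣ x X

-- Serves two passages that must not increase cardinality: from product colours to representatives,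
-- and from product colours to the colours of one piece. `Maybe` covers colours that do not occur
-- and vertices outside the piece.
partial-image : (f : Fin k → Maybe (Fin n)) (I : Subset k) →
  ∃[ X ] ∣ X ∣ ≤ ∣ I ∣ × (∀ {a x} → a ∈ I → f a ≡ just x → x ∈ X)
partial-image {n = n} f [] = ⊥ , ≤-reflexive (∣⊥∣≡0 n) , λ ()
partial-image f (false ∷ I) with partial-image (f ∘ suc) I
... | X , X≤I , image = X , X≤I , λ { (Vec.there a∈I) → image a∈I }
partial-image f (true ∷ I) with partial-image (f ∘ suc) I | f zero in eq
... | X , X≤I , image | nothing =
  X , m≤n⇒m≤1+n X≤I , λ { Vec.here fa → ⊥-elim (nothing≢just (trans (sym eq) fa))
                        ; (Vec.there a∈I) → image a∈I }
  where
  nothing≢just : ∀ {x : Fin _} → nothing ≢ just x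
  nothing≢just ()
... | X , X≤I , image | just y =
  X Vec.[ y ]≔ true , ≤-trans (∣insert∣ y X) (s≤s X≤I) , λ where
    Vec.here fa → subst (_∈ _) (just-injective (trans (sym eq) fa)) ([]≔-updates X y)
    (Vec.there {i = a} a∈I) fa → weaken (image a∈I fa)
  where
  weaken : ∀ {x} → x ∈ X → x ∈ X Vec.[ y ]≔ true
  weaken {x} x∈X with x Fin.≟ y
  ... | yes refl = []≔-updates X y
  ... | no x≢y   = []≔-minimal X x y x≢y x∈X

module _ (G : Graph) (X : Subset (order G)) where

  vertex : Vertex (induced G X) → Vertex G
  vertex = List.lookup (members X)

  vertex-injective : Injective _≡_ _≡_ vertex
  vertex-injective = lookup-injective (Unique.filter⁺ (_∈? X) (Unique.allFin⁺ _))

  vertex∈ : ∀ i → vertex i ∈ X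
  vertex∈ i = proj₂ (∈-filter⁻ (_∈? X) {xs = allFin _} (∈-lookup i))

  position : ∀ {v} → v ∈ X → Vertex (induced G X)
  position v∈X = Any.index (∈-filter⁺ (_∈? X) (∈-allFin _) v∈X)

  vertex-position : ∀ {v} (v∈X : v ∈ X) → vertex (position v∈X) ≡ v
  vertex-position v∈X = sym (lookup-index (∈-filter⁺ (_∈? X) (∈-allFin _) v∈X))

∈-preimage⁻ : (c : Fin n → Fin k) {I : Subset k} → ∀ {v} → v ∈ preimage c I → c v ∈ I
∈-preimage⁻ c {I} {v} v∈ =
  lookup⇒[]= (c v) I (trans (sym (lookup∘tabulate _ v)) ([]=⇒lookup v∈))

module ProductColouring
  (G : Graph) {p : ℕ} (F : List (Subset (order G)))
  (covers : ∀ X → ∣ X ∣ ≤ p → Any (X ⊆_) F)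
  (colourings : All (λ Y → CentredColouring p (induced G Y) k) F)
  where

  piece : Fin (length F) → Subset (order G)
  piece = List.lookup F

  module Piece (i : Fin (length F)) where
    private colouring = All.lookup colourings (∈-lookup i)
    Y   = piece i
    ρ   = proj₁ colouring
    ρ-injective = proj₁ (proj₂ colouring)
    c   = proj₁ (proj₂ (proj₂ colouring))
    centred = proj₂ (proj₂ (proj₂ colouring))

    -- zero is the colour of the vertices outside the piece.
    extended : Vertex G → Fin (suc k)
    extended v with v ∈? Y
    ... | yes v∈Y = suc (c (position G Y v∈Y))
    ... | no _    = zero

    extended-∈ : ∀ {v} (v∈Y : v ∈ Y) → extended v ≡ suc (c (position G Y v∈Y))
    extended-∈ {v} v∈Y with v ∈? Y
    ... | yes v∈Y′ = cong (suc ∘ c) (vertex-injective G Y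
                       (trans (vertex-position G Y v∈Y′) (sym (vertex-position G Y v∈Y))))
    ... | no v∉Y   = ⊥-elim (v∉Y v∈Y)

    extended-∈⁻ : ∀ {u v} → extended u ≡ extended v → u ∈ Y → v ∈ Y
    extended-∈⁻ {u} {v} eq u∈Y with v ∈? Y
    ... | yes v∈Y = v∈Y
    ... | no v∉Y with () ← trans (sym (extended-∈ u∈Y)) eq

  product : Vertex G → Fin (suc k ^ length F)
  product v = funToFin λ i → Piece.extended i v

  product-component : ∀ v i → finToFun (product v) i ≡ Piece.extended i v
  product-component v = Fin.finToFun-funToFin λ i → Piece.extended i v

  product-cong : ∀ {u v} → product u ≡ product v → ∀ i → Piece.extended i u ≡ Piece.extended i v
  product-cong {u} {v} eq i =
    trans (sym (product-component u i))
          (trans (cong (λ a → finToFun a i) eq) (product-component v i))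

  representative : Fin (suc k ^ length F) → Maybe (Vertex G)
  representative a with Fin.any? (λ v → product v Fin.≟ a)
  ... | yes (v , _) = just v
  ... | no _        = nothing

  representative-product : ∀ v → ∃[ u ] representative (product v) ≡ just u × product u ≡ product v
  representative-product v with Fin.any? (λ u → product u Fin.≟ product v)
  ... | yes (u , eq) = u , refl , eq
  ... | no ¬ex       = ⊥-elim (¬ex (v , refl))

  component : Fin (length F) → Fin (suc k ^ length F) → Maybe (Fin k)
  component i a with finToFun a i
  ... | zero  = nothing
  ... | suc b = just b

  component-product : ∀ i v (v∈Y : v ∈ piece i) →
    component i (product v) ≡ just (Piece.c i (position G (piece i) v∈Y))
  component-product i v v∈Y rewrite product-component v i | Piece.extended-∈ i v∈Y = refl

  -- A piece containing one vertex of each colour of I contains every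
  -- vertex coloured in I, because the colour of a vertex determines the
  -- pieces it belongs to.
  lowTreeDepth : ¬ ¬ (LowTreeDepthColouring p G (suc k ^ length F) product)
  lowTreeDepth = ¬¬-Subset classes
    where
    classes : ∀ I → ¬ ¬ (∣ I ∣ ≤ p → IsTreeDepth (induced G (preimage product I)) AtMost ∣ I ∣)
    classes I ¬td with ∣ I ∣ ≤? p
    ... | no I≰p = ¬td (⊥-elim ∘ I≰p)
    ... | yes I≤p with partial-image representative I
    ...   | X , X≤I , repr∈X =
      treeDepth-bound (induced G Z) (ρ ∘ φ) (φ-injective ∘ ρ-injective) (c ∘ φ)
        (λ {u} walk eq → φ-injective (centred J (≤-trans J≤I I≤p)
           (walk-map φ (φ-hom _ _) (λ {x} ρ≤ → ρ≤ , colour∈J x) walk) eq))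
        J colour∈J λ { (i , td , i≤J) → ¬td λ _ → i , td , ≤-trans i≤J J≤I }
      where
      Z = preimage product I
      cover = covers X (≤-trans X≤I I≤p)
      i = Any.index cover
      open Piece i
      X⊆Y : X ⊆ Y
      X⊆Y = lookup-index cover

      Z⊆Y : ∀ {v} → v ∈ Z → v ∈ Y
      Z⊆Y {v} v∈Z with representative-product v
      ... | u , repr , eq =
        extended-∈⁻ (product-cong eq i) (X⊆Y (repr∈X (∈-preimage⁻ product v∈Z) repr))

      inZ : ∀ z → vertex G Z z ∈ Y
      inZ z = Z⊆Y (vertex∈ G Z z)

      φ : Vertex (induced G Z) → Vertex (induced G Y)
      φ z = position G Y (inZ z)

      vertex-φ : ∀ z → vertex G Y (φ z) ≡ vertex G Z z
      vertex-φ z = vertex-position G Y (inZ z)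

      φ-injective : Injective _≡_ _≡_ φ
      φ-injective {x} {y} eq = vertex-injective G Z
        (trans (sym (vertex-φ x)) (trans (cong (vertex G Y) eq) (vertex-φ y)))

      φ-hom : ∀ x y → Adjacent (induced G Z) x y → Adjacent (induced G Y) (φ x) (φ y)
      φ-hom x y = subst₂ (Adjacent G) (sym (vertex-φ x)) (sym (vertex-φ y))

      J = proj₁ (partial-image (component i) I)
      J≤I = proj₁ (proj₂ (partial-image (component i) I))

      colour∈J : ∀ z → c (φ z) ∈ J
      colour∈J z = proj₂ (proj₂ (partial-image (component i) I))
        (∈-preimage⁻ product (vertex∈ G Z z)) (component-product i (vertex G Z z) (inZ z))

-- Inside a single colour class of a proper colouring every walk is trivial, so any injective order
-- will do.
proper⇒centred : (G : Graph) (c : Vertex G → Fin k) →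
                 (∀ {u v} → Adjacent G u v → c u ≢ c v) → CentredColouring 1 G k
proper⇒centred {k = k} G c proper = toℕ , Fin.toℕ-injective , c , centred
  where
  ∈-unique : (J : Subset k) → ∣ J ∣ ≤ 1 → ∀ {x y} → x ∈ J → y ∈ J → x ≡ y
  ∈-unique J J≤1 {x} {y} x∈J y∈J = decidable-stable (x Fin.≟ y) λ x≢y →
    n≮n 1 (≤-trans (s≤s (≤-trans (s≤s z≤n) (x∈p⇒∣p-x∣<∣p∣ (x∈p∧x≢y⇒x∈p-y x∈J x≢y))))
                   (≤-trans (x∈p⇒∣p-x∣<∣p∣ y∈J) J≤1))

  centred : Centred 1 G toℕ c
  centred J J≤1 (Walk.here _) _ = refl
  centred J J≤1 (Walk.step (_ , a∈J) ab w) _ =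
    ⊥-elim (proper ab (∈-unique J J≤1 a∈J (proj₂ (walk-start w))))

-- Shortening walks with few colours

-- Equals 2^(j+1) - 2. A walk with j + 1 colours splits at its minimum into two halves, each a walk
-- with j colours and one more edge.
shortLength : ℕ → ℕ
shortLength zero    = 0
shortLength (suc j) = suc (shortLength j) + suc (shortLength j)

shortLength-mono : ∀ {i j} → i ≤ j → shortLength i ≤ shortLength j
shortLength-mono z≤n       = z≤n
shortLength-mono (s≤s i≤j) = +-mono-≤ (s≤s (shortLength-mono i≤j)) (s≤s (shortLength-mono i≤j))

-- Distinct colours along short walks to a minimal vertex force distinct
-- colours along all walks with few colours: such walks can be shortened.
module Shortening
  (G : Graph) (p : ℕ) (ρ : Vertex G → ℕ) (ρ-inj : Injective _≡_ _≡_ ρ) (c : Vertex G → Fin k)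
  (short-centre : ∀ {u v l} → l ≤ shortLength p →
     Walk (Adjacent G) (λ x → ρ u ≤ ρ x) l v u → c u ≡ c v → u ≡ v)
  where

  W : Pred (Vertex G) 0ℓ → ℕ → Rel (Vertex G) 0ℓ
  W = Walk (Adjacent G)

  split-at-minimum : ∀ {P a b} → W P l a b → ∃[ m ]
    (∃[ l₁ ] W (λ x → P x × ρ m ≤ ρ x) l₁ a m) × (∃[ l₂ ] W (λ x → P x × ρ m ≤ ρ x) l₂ b m)
  split-at-minimum {a = a} (here Pa) =
    a , (0 , here (Pa , ≤-refl)) , (0 , here (Pa , ≤-refl))
  split-at-minimum {a = a} (step Pa ab w) with split-at-minimum w
  ... | m , (l₁ , w₁) , (l₂ , w₂) with ≤-total (ρ m) (ρ a)
  ...   | inj₁ m≤a = m , (suc l₁ , step (Pa , m≤a) ab w₁) , (l₂ , w₂)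
  ...   | inj₂ a≤m = a , (0 , here (Pa , ≤-refl)) , (_ ,
    walk-snoc (walk-++ (walk-weaken above w₂) (walk-reverse sym-adj (walk-weaken above w₁)))
              (sym-adj ab) (Pa , ≤-refl))
    where
    sym-adj = Adjacent-sym G
    above : ∀ {x} → _ × ρ m ≤ ρ x → _ × ρ a ≤ ρ x
    above = map₂ (≤-trans a≤m)

  -- Induction on the number of colours. Each half of the walk approaches the `ρ`-minimum `m`
  -- without using its colour, so up to the last edge it has one colour fewer. `P` is arbitrary
  -- because recursive calls must also keep the walk above `m`.
  shorten : ∀ j → j ≤ p → ∀ {P} (J : Subset k) → ∣ J ∣ ≤ j → ∀ {a b} →
            W (λ x → P x × c x ∈ J) l a b → ∃[ l′ ] l′ ≤ shortLength j × W P l′ a b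
  shorten zero _ J J≤0 w =
    ⊥-elim (n≮0 (<-≤-trans (x∈p⇒∣p-x∣<∣p∣ (proj₂ (walk-start w))) J≤0))
  shorten (suc j) j<p {P} J J≤j w with split-at-minimum w
  ... | m , (_ , w₁) , (_ , w₂) with toMinimum w₁ | toMinimum w₂
    where
    Above : Pred (Vertex G) 0ℓ
    Above x = P x × ρ m ≤ ρ x

    -- The two extra edges are the one leaving `a` and the one entering `m`.
    room : 2 + shortLength j ≤ shortLength p
    room = ≤-trans (s≤s (m≤n+m _ (shortLength j))) (shortLength-mono j<p)

    -- The walk is cut before its first visit to `m`. The stretch after `a` already avoids the
    -- colour of `m`, so it can be shortened; if `a` had that colour, `short-centre` would force `a`
    -- to be `m`.
    approach : ∀ {l a} → W (λ x → (P x × c x ∈ J) × ρ m ≤ ρ x) l a m →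
      a ≡ m ⊎ (∃[ l′ ] ∃[ y ] W (λ x → Above x × c x ∈ J - c m) l′ a y × Adjacent G y m)
    approach (here _) = inj₁ refl
    approach {a = a} (step ((Pa , a∈J) , m≤a) ab w) with a Fin.≟ m
    ... | yes a≡m = inj₁ a≡m
    ... | no a≢m with approach w
    ...   | inj₁ refl = inj₂ (0 , a , here ((Pa , m≤a) , x∈p∧x≢y⇒x∈p-y a∈J differs) , ab)
      where
      differs : c a ≢ c m
      differs eq = a≢m (sym (short-centre (≤-trans (s≤s z≤n) room)
                                          (step m≤a ab (here ≤-refl)) (sym eq)))
    ...   | inj₂ (l′ , y , v , ym) =
      inj₂ (suc l′ , y , step ((Pa , m≤a) , x∈p∧x≢y⇒x∈p-y a∈J differs) ab v , ym)
      where
      differs : c a ≢ c m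
      differs eq with shorten j (<⇒≤ j<p) (J - c m) (≤-pred (<-≤-trans (x∈p⇒∣p-x∣<∣p∣ m∈J) J≤j)) v
        where
        m∈J : c m ∈ J
        m∈J = subst (_∈ J) eq a∈J
      ... | l″ , l″≤ , v′ = a≢m (sym (short-centre (≤-trans (s≤s (s≤s l″≤)) room)
              (step m≤a ab (walk-snoc (walk-weaken proj₂ v′) ym ≤-refl)) (sym eq)))

    minimum∈ : ∀ {Q : Pred (Vertex G) 0ℓ} {l a} → W Q l a m → Q m
    minimum∈ (here Qm)    = Qm
    minimum∈ (step _ _ w) = minimum∈ w

    toMinimum : ∀ {l a} → W (λ x → (P x × c x ∈ J) × ρ m ≤ ρ x) l a m →
                ∃[ l′ ] l′ ≤ suc (shortLength j) × W P l′ a m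
    toMinimum w with approach w
    ... | inj₁ refl = 0 , z≤n , here (proj₁ (proj₁ (walk-start w)))
    ... | inj₂ (_ , y , v , ym)
      with shorten j (<⇒≤ j<p) (J - c m)
             (≤-pred (<-≤-trans (x∈p⇒∣p-x∣<∣p∣ (proj₂ (proj₁ (minimum∈ w)))) J≤j)) v
    ...   | l′ , l′≤ , v′ =
      suc l′ , s≤s l′≤ , walk-snoc (walk-weaken proj₁ v′) ym (proj₁ (proj₁ (minimum∈ w)))
  ... | l₁ , l₁≤ , w₁′ | l₂ , l₂≤ , w₂′ =
    l₁ + l₂ , +-mono-≤ l₁≤ l₂≤ , walk-++ w₁′ (walk-reverse (Adjacent-sym G) w₂′)

  shortCentred : Centred p G ρ c
  shortCentred J J≤p w with shorten p ≤-refl J J≤p w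
  ... | _ , l≤ , w′ = short-centre l≤ w′

-- Greedy colourings

length-concatMap-≤ : ∀ {b} (f : A → List B) → (∀ x → length (f x) ≤ b) →
                     ∀ xs → length (concatMap f xs) ≤ length xs * b
length-concatMap-≤ f f≤b []       = z≤n
length-concatMap-≤ f f≤b (x ∷ xs) =
  ≤-trans (≤-reflexive (length-++ (f x))) (+-mono-≤ (f≤b x) (length-concatMap-≤ f f≤b xs))

∈-concatMap : ∀ {y : B} {x : A} (f : A → List B) {xs} → x ∈ˡ xs → y ∈ˡ f x → y ∈ˡ concatMap f xs
∈-concatMap f (here refl)  y∈ = ∈-++⁺ˡ y∈
∈-concatMap f (there {x} x∈xs) y∈ = ∈-++⁺ʳ (f x) (∈-concatMap f x∈xs y∈)

fresh : (xs : List (Fin (suc n))) → length xs ≤ n → ∃[ x ] x ∉ˡ xs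
fresh {n} xs xs≤n with Fin.any? (λ x → ¬? (mem? Fin._≟_ x xs))
... | yes x∉ = x∉
... | no all = ⊥-elim (n≮n n (≤-trans (Fin.injective⇒≤ index-injective) xs≤n))
  where
  x∈xs : ∀ x → x ∈ˡ xs
  x∈xs x = decidable-stable (mem? Fin._≟_ x xs) (λ x∉ → all (x , x∉))

  index-injective : Injective _≡_ _≡_ (λ x → Any.index (x∈xs x))
  index-injective {x} {y} eq =
    trans (lookup-index (x∈xs x)) (trans (cong (List.lookup xs) eq) (sym (lookup-index (x∈xs y))))

-- Recursion on the bound `b`: everything of rank at least `b` is recoloured against the colours
-- already fixed below. Colours beyond the bound are provisional.
greedy : (ρ : A → ℕ) (back : A → List A) → (∀ a → length (back a) ≤ n) → ∀ b →
         Σ (A → Fin (suc n)) λ c → ∀ {x y} → y ∈ˡ back x → ρ y < ρ x → ρ x < b → c y ≢ c x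
greedy ρ back bounded zero = (λ _ → zero) , λ _ _ ()
greedy {A = A} {n = n} ρ back bounded (suc b) with greedy ρ back bounded b
... | c , c-good = c′ , good
  where
  free : ∀ a → ∃[ i ] i ∉ˡ List.map c (back a)
  free a = fresh (List.map c (back a)) (subst (_≤ n) (sym (length-map c (back a))) (bounded a))

  c′ : A → Fin (suc n)
  c′ a with ρ a <? b
  ... | yes _ = c a
  ... | no _  = proj₁ (free a)

  good : ∀ {x y} → y ∈ˡ back x → ρ y < ρ x → ρ x < suc b → c′ y ≢ c′ x
  good {x} {y} y∈ y<x (s≤s x≤b) with ρ y <? b | ρ x <? b
  ... | no y≮b | _       = ⊥-elim (y≮b (<-≤-trans y<x x≤b))
  ... | yes _  | yes x<b = c-good y∈ y<x x<b
  ... | yes _  | no _    = λ eq → proj₂ (free x) (subst (_∈ˡ _) eq (∈-map⁺ c y∈))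

-- Strongly and weakly reachable vertices

-- Strong `r`-reachability: `y` is the first vertex below `v` on the walk. The edge into `y` counts,
-- hence `l < r` for walks of length at most `r`.
StrongReachBound : (G : Graph) → (Vertex G → ℕ) → ℕ → ℕ → Set
StrongReachBound G ρ r b = ∀ v → ∃[ S ] length S ≤ b × (∀ {x y l} → l < r →
  Walk (Adjacent G) (λ z → ρ v ≤ ρ z) l v x → Adjacent G x y → ρ y < ρ v → y ∈ˡ S)

module WeakReach (G : Graph) (ρ : Vertex G → ℕ) (ρ-inj : Injective _≡_ _≡_ ρ)
                 {r b : ℕ} (strong : StrongReachBound G ρ r b) where

  strongly : Vertex G → List (Vertex G)
  strongly v = proj₁ (strong v)

  weakly : ℕ → Vertex G → List (Vertex G)
  weakly zero    v = v ∷ []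
  weakly (suc f) v = concatMap (weakly f) (v ∷ strongly v)

  length-weakly : ∀ f v → length (weakly f v) ≤ suc b ^ f
  length-weakly zero    v = ≤-refl
  length-weakly (suc f) v =
    ≤-trans (length-concatMap-≤ (weakly f) (length-weakly f) (v ∷ strongly v))
            (*-monoˡ-≤ (suc b ^ f) (s≤s (proj₁ (proj₂ (strong v)))))

  self∈weakly : ∀ f v → v ∈ˡ weakly f v
  self∈weakly zero    v = here refl
  self∈weakly (suc f) v = ∈-concatMap (weakly f) {xs = v ∷ strongly v} (here refl) (self∈weakly f v)

  -- Cutting the walk wherever it drops below its current start leaves a chain of strong reaches.
  -- `past` is the stretch since the last drop, and `f` bounds the drops to come.
  reach∈weakly : ∀ {u} f {v x j l} → l ≤ f → j + l ≤ r → ρ u ≤ ρ v →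
    Walk (Adjacent G) (λ z → ρ v ≤ ρ z) j v x → Walk (Adjacent G) (λ z → ρ u ≤ ρ z) l x u →
    u ∈ˡ weakly f v
  reach∈weakly {u} f {v} _ _ u≤v past (here _) =
    subst (_∈ˡ weakly f v) (ρ-inj (≤-antisym (end past) u≤v)) (self∈weakly f v)
    where
    end : ∀ {a j b} → Walk (Adjacent G) (λ z → ρ v ≤ ρ z) j a b → ρ v ≤ ρ b
    end (here h)     = h
    end (step _ _ w) = end w
  reach∈weakly (suc f) {v} {x} {j} {suc l} (s≤s l≤f) j+l≤r u≤v past (step {b = y} _ xy rest)
    with ρ v ≤? ρ y
  ... | yes v≤y = reach∈weakly (suc f) (m≤n⇒m≤1+n l≤f)
                    (≤-trans (≤-reflexive (sym (+-suc j l))) j+l≤r) u≤v (walk-snoc past xy v≤y) rest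
  ... | no v≰y  = ∈-concatMap (weakly f) {xs = v ∷ strongly v}
    (there (proj₂ (proj₂ (strong v)) (≤-trans (m<m+n j (s≤s z≤n)) j+l≤r) past xy (≰⇒> v≰y)))
    (reach∈weakly f l≤f (≤-trans (m≤n+m l j) (≤-trans (+-monoʳ-≤ j (n≤1+n l)) j+l≤r))
       (walk-start rest) (here ≤-refl) rest)

strongReach⇒centred : (G : Graph) (ρ : Vertex G → ℕ) → Injective _≡_ _≡_ ρ →
  ∀ p {b} → StrongReachBound G ρ (shortLength p) b →
  CentredColouring p G (suc (suc b ^ shortLength p))
strongReach⇒centred G ρ ρ-inj p {b} strong = ρ , ρ-inj , c , shortCentred
  where
  open WeakReach G ρ ρ-inj strong
  r = shortLength p

  top : ℕ
  top = suc (foldr _⊔_ 0 (List.tabulate ρ))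

  below-top : ∀ {n} (f : Fin n → ℕ) i → f i ≤ foldr _⊔_ 0 (List.tabulate f)
  below-top f zero    = m≤m⊔n _ _
  below-top f (suc i) = m≤n⇒m≤o⊔n _ (below-top (f ∘ suc) i)

  colouring = greedy ρ (weakly r) (length-weakly r) top
  c = proj₁ colouring

  open Shortening G p ρ ρ-inj c (λ {u} {v} l≤r w eq → decidable-stable (u Fin.≟ v) λ u≢v →
    proj₂ colouring (reach∈weakly r l≤r l≤r (walk-start w) (here ≤-refl) w)
      (≤∧≢⇒< (walk-start w) (u≢v ∘ ρ-inj)) (s≤s (below-top ρ v)) eq)

-- Stages of a contraction sequence

-- The parts are the vertices of the trigraph; part sends a vertex of G to
-- the one it has been contracted into.
record Stage (G : Graph) (n : ℕ) : Set where
  field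
    tri  : Trigraph n
    part : Vertex G → Fin n
    black⇒adjacent : ∀ x y → edge tri (part x) (part y) ≡ black → Adjacent G x y
    -- Inside one part the trigraph has edge `none`, whatever the adjacencies in `G`.
    none⇒¬adjacent : ∀ x y → part x ≢ part y →
                     edge tri (part x) (part y) ≡ none → ¬ Adjacent G x y

open Stage

initial : (G : Graph) → Stage G (order G)
initial G = record
  { tri  = fromGraph G
  ; part = id
  ; black⇒adjacent = black⇒
  ; none⇒¬adjacent = λ x y _ → none⇒ x y
  }
  where
  black⇒ : ∀ x y → edge (fromGraph G) x y ≡ black → Adjacent G x y
  black⇒ x y eq with Graph.adj G x y
  black⇒ x y _  | true = tt

  none⇒ : ∀ x y → edge (fromGraph G) x y ≡ none → ¬ Adjacent G x y
  none⇒ x y eq with Graph.adj G x y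
  none⇒ x y _  | false = id

initial-black : (G : Graph) → ∀ {x y} → Adjacent G x y → edge (fromGraph G) x y ≡ black
initial-black G {x} {y} xy with Graph.adj G x y
... | true = refl

module Contraction (u v : Fin (suc n)) (u≢v : u ≢ v) where

  collapse : Fin (suc n) → Fin n
  collapse q with v Fin.≟ q
  ... | yes _   = punchOut (u≢v ∘ sym)
  ... | no v≢q  = punchOut v≢q

  punchIn-collapse : ∀ q → (q ≡ v × punchIn v (collapse q) ≡ u) ⊎
                           (q ≢ v × punchIn v (collapse q) ≡ q)
  punchIn-collapse q with v Fin.≟ q
  ... | yes v≡q = inj₁ (sym v≡q , Fin.punchIn-punchOut _)
  ... | no v≢q  = inj₂ (v≢q ∘ sym , Fin.punchIn-punchOut _)

  collapse-injective : ∀ {q r} → collapse q ≡ collapse r →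
                       q ≢ u → q ≢ v → q ≡ r
  collapse-injective {q} {r} eq q≢u q≢v with punchIn-collapse q | punchIn-collapse r
  ... | inj₁ (q≡v , _) | _                = ⊥-elim (q≢v q≡v)
  ... | inj₂ (_ , eq₁) | inj₁ (_ , eq₂)   =
    ⊥-elim (q≢u (trans (sym eq₁) (trans (cong (punchIn v) eq) eq₂)))
  ... | inj₂ (_ , eq₁) | inj₂ (_ , eq₂)   = trans (sym eq₁) (trans (cong (punchIn v) eq) eq₂)

  collapse-preimage : ∀ {q} → q ≡ v ⊎ q ≡ punchIn v (collapse q)
  collapse-preimage {q} with punchIn-collapse q
  ... | inj₁ (q≡v , _) = inj₁ q≡v
  ... | inj₂ (_ , eq)  = inj₂ (sym eq)

  merge-black : ∀ {a b} → merge a b ≡ black → a ≡ black × b ≡ black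
  merge-black {black} {black} _  = refl , refl
  merge-black {black} {none}  ()
  merge-black {black} {red}   ()

  merge-none : ∀ {a b} → merge a b ≡ none → a ≡ none × b ≡ none
  merge-none {none} {none}  _  = refl , refl
  merge-none {none} {black} ()
  merge-none {none} {red}   ()

  module _ (t : Trigraph (suc n)) where

    -- The hypothesis on e holds for black and none.
    contract-edge : ∀ {e} → (∀ {a b} → merge a b ≡ e → a ≡ e × b ≡ e) → ∀ q r →
      collapse q ≢ collapse r → edge (contract t u v) (collapse q) (collapse r) ≡ e →
      edge t q r ≡ e
    contract-edge merge-e q r q≢r eq
      with punchIn v (collapse q) Fin.≟ u | punchIn v (collapse r) Fin.≟ u
    ... | yes q≡u | yes r≡u =
      ⊥-elim (q≢r (Fin.punchIn-injective v _ _ (trans q≡u (sym r≡u))))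
    ... | yes q≡u | no r≢u with punchIn-collapse q | punchIn-collapse r
    ...   | _               | inj₁ (_ , r≡u) = ⊥-elim (r≢u r≡u)
    ...   | inj₁ (refl , _) | inj₂ (_ , r≡)  =
      proj₂ (merge-e (trans (cong₂ merge (cong (edge t u) (sym r≡)) (cong (edge t v) (sym r≡))) eq))
    ...   | inj₂ (_ , q≡)   | inj₂ (_ , r≡)  =
      trans (cong₂ (edge t) (trans (sym q≡) q≡u) (sym r≡)) (proj₁ (merge-e eq))
    contract-edge merge-e q r q≢r eq
        | no q≢u | yes r≡u with punchIn-collapse q | punchIn-collapse r
    ...   | inj₁ (_ , q≡u) | _               = ⊥-elim (q≢u q≡u)
    ...   | inj₂ (_ , q≡)  | inj₁ (refl , _) =
      trans (Trigraph.edge-sym t q r)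
        (trans (cong (edge t r) (sym q≡)) (proj₂ (merge-e eq)))
    ...   | inj₂ (_ , q≡)  | inj₂ (_ , r≡)   =
      trans (Trigraph.edge-sym t q r)
        (trans (cong₂ (edge t) (trans (sym r≡) r≡u) (sym q≡)) (proj₁ (merge-e eq)))
    contract-edge merge-e q r q≢r eq
        | no q≢u | no r≢u with punchIn-collapse q | punchIn-collapse r
    ...   | inj₁ (_ , q≡u) | _              = ⊥-elim (q≢u q≡u)
    ...   | inj₂ _         | inj₁ (_ , r≡u) = ⊥-elim (r≢u r≡u)
    ...   | inj₂ (_ , q≡)  | inj₂ (_ , r≡)  = trans (cong₂ (edge t) (sym q≡) (sym r≡)) eq

    contract-black : ∀ q r → edge (contract t u v) (collapse q) (collapse r) ≡ black →
                     edge t q r ≡ black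
    contract-black q r eq = contract-edge merge-black q r distinct eq
      where
      distinct : collapse q ≢ collapse r
      distinct q≡r with () ←
        trans (sym eq) (trans (cong (edge (contract t u v) (collapse q)) (sym q≡r))
                              (Trigraph.edge-irrefl (contract t u v) (collapse q)))

  contracted : {G : Graph} → Stage G (suc n) → Stage G n
  contracted σ = record
    { tri  = contract (tri σ) u v
    ; part = collapse ∘ part σ
    ; black⇒adjacent = λ x y eq →
        black⇒adjacent σ x y (contract-black (tri σ) (part σ x) (part σ y) eq)
    ; none⇒¬adjacent = λ x y x≢y eq →
        none⇒¬adjacent σ x y (x≢y ∘ cong collapse)
          (contract-edge (tri σ) merge-none (part σ x) (part σ y) x≢y eq)
    }

open Contraction using (contracted; collapse; collapse-injective; collapse-preimage; contract-black)

redDegree-bound : {t : Trigraph n} → ContractionSequence d t → ∀ q → redDegree t q ≤ d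
redDegree-bound (stop _ red≤d)       = red≤d
redDegree-bound (step red≤d _ _ _ _) = red≤d

ContractionSequence-mono : ∀ {e} → d ≤ e → {t : Trigraph n} →
                           ContractionSequence d t → ContractionSequence e t
ContractionSequence-mono d≤e (stop n≤1 red≤d) = stop n≤1 λ x → ≤-trans (red≤d x) d≤e
ContractionSequence-mono d≤e (step red≤d u v u≢v seq) =
  step (λ x → ≤-trans (red≤d x) d≤e) u v u≢v (ContractionSequence-mono d≤e seq)

-- For a property Φ of parts which persists under contraction, the level
-- of a vertex is the number of parts at the first stage where its part
-- has Φ (0 if there is none), and its cell is its part one stage before.
module FirstTime (G : Graph) (d : ℕ)
  (Φ : ∀ {n} → Stage G n → Vertex G → Set)
  (Φ? : ∀ {n} (σ : Stage G n) x → Dec (Φ σ x))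
  (Φ-part : ∀ {n} (σ : Stage G n) {x y} → part σ x ≡ part σ y → Φ σ x → Φ σ y)
  (Φ-contracted : ∀ {n} (σ : Stage G (suc n)) u v (u≢v : u ≢ v) {x} →
                  Φ σ x → Φ (contracted u v u≢v σ) x)
  where

  module _ (level cell : Vertex G → ℕ) (v : Vertex G) where

    -- Later stages have fewer parts, so a larger level means an earlier arrival. `ahead-cell` holds
    -- because vertices once in a common part stay together from then on.
    record Arrival : Set where
      field
        parts    : ℕ
        before   : Stage G (suc parts)
        s t      : Fin (suc parts)
        distinct : s ≢ t

      after : Stage G parts
      after = contracted s t distinct before

      field
        red≤d      : ∀ q → redDegree (tri after) q ≤ d
        level≡     : level v ≡ parts
        arrived    : ∀ {x} → level v ≤ level x → Φ after x
        ahead      : ∀ {x} → level x < level v → ¬ Φ after x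
        same-level : ∀ {x} → level x ≡ level v → ¬ Φ before x × cell x ≡ toℕ (part before x)
        ahead-cell : ∀ {x y} → level x < level v → part after x ≡ part after y →
                     level x ≡ level y × cell x ≡ cell y

    record Never : Set where
      field
        parts   : ℕ
        final   : Stage G parts
        parts≤1 : parts ≤ 1
        ahead   : ∀ {x} → level x ≤ level v → ¬ Φ final x

  record Levels (σ : Stage G n) : Set where
    field
      level cell : Vertex G → ℕ
      level≤     : ∀ x → level x ≤ n
      cell≤      : ∀ x → cell x ≤ n
      level-Φ    : ∀ {x} → Φ σ x → level x ≡ n
      level-¬Φ   : ∀ {x} → ¬ Φ σ x → level x < n
      same-part  : ∀ {x y} → ¬ Φ σ x → part σ x ≡ part σ y →
                   level x ≡ level y × cell x ≡ cell y
      first-time : ∀ v → ¬ Φ σ v → Arrival level cell v ⊎ Never level cell v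

  -- The levels are built backwards from the last stage. Prepending a contraction only moves
  -- vertices that have `Φ` at `σ`, from level `n` to `suc n`, so the arrivals recorded for later
  -- stages survive.
  module Extend {n} (σ : Stage G (suc n)) (s t : Fin (suc n)) (s≢t : s ≢ t)
                (red≤d′ : ∀ q → redDegree (tri (contracted s t s≢t σ)) q ≤ d)
                (L : Levels (contracted s t s≢t σ)) where

    private
      σ′ = contracted s t s≢t σ
      module L = Levels L

    level cell : Vertex G → ℕ
    level x = if does (Φ? σ x) then suc n else L.level x
    -- For a vertex with `Φ` already at `σ` this is a placeholder; it is the true cell when `Φ`
    -- arrives just now.
    cell  x = if does (Φ? σ′ x) then toℕ (part σ x) else L.cell x

    level-Φ : ∀ {x} → Φ σ x → level x ≡ suc n
    level-Φ {x} Φx with Φ? σ x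
    ... | yes _  = refl
    ... | no ¬Φx = ⊥-elim (¬Φx Φx)

    level-¬Φ : ∀ {x} → ¬ Φ σ x → level x ≡ L.level x
    level-¬Φ {x} ¬Φx with Φ? σ x
    ... | yes Φx = ⊥-elim (¬Φx Φx)
    ... | no _   = refl

    cell-Φ : ∀ {x} → Φ σ′ x → cell x ≡ toℕ (part σ x)
    cell-Φ {x} Φx with Φ? σ′ x
    ... | yes _  = refl
    ... | no ¬Φx = ⊥-elim (¬Φx Φx)

    cell-¬Φ : ∀ {x} → ¬ Φ σ′ x → cell x ≡ L.cell x
    cell-¬Φ {x} ¬Φx with Φ? σ′ x
    ... | yes Φx = ⊥-elim (¬Φx Φx)
    ... | no _   = refl

    level≤ : ∀ x → level x ≤ suc n
    level≤ x with Φ? σ x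
    ... | yes _ = ≤-refl
    ... | no _  = m≤n⇒m≤1+n (L.level≤ x)

    cell≤ : ∀ x → cell x ≤ suc n
    cell≤ x with Φ? σ′ x
    ... | yes _ = <⇒≤ (Fin.toℕ<n (part σ x))
    ... | no _  = m≤n⇒m≤1+n (L.cell≤ x)

    ¬Φ-before : ∀ {x} → ¬ Φ σ′ x → ¬ Φ σ x
    ¬Φ-before ¬Φ′x = ¬Φ′x ∘ Φ-contracted σ s t s≢t

    same-part : ∀ {x y} → ¬ Φ σ x → part σ x ≡ part σ y → level x ≡ level y × cell x ≡ cell y
    same-part {x} {y} ¬Φx eq with Φ? σ′ x
    ... | yes Φ′x =
      trans (level-¬Φ ¬Φx) (trans (L.level-Φ Φ′x)
        (sym (trans (level-¬Φ (¬Φx ∘ Φ-part σ (sym eq))) (L.level-Φ Φ′y)))) ,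
      trans (cong toℕ eq) (sym (cell-Φ Φ′y))
      where Φ′y = Φ-part σ′ (cong (collapse s t s≢t) eq) Φ′x
    ... | no ¬Φ′x with L.same-part ¬Φ′x (cong (collapse s t s≢t) eq)
    ...   | lev , cel =
      trans (level-¬Φ ¬Φx) (trans lev (sym (level-¬Φ (¬Φx ∘ Φ-part σ (sym eq))))) ,
      trans cel (sym (cell-¬Φ (¬Φ′x ∘ Φ-part σ′ (sym (cong (collapse s t s≢t) eq)))))

    -- level x and L.level x are equal below n, and otherwise both ≥ n.
    level-mono : ∀ {x} → L.level x ≤ level x
    level-mono {x} with Φ? σ x
    ... | yes _ = m≤n⇒m≤1+n (L.level≤ x)
    ... | no _  = ≤-refl

    below : ∀ {x} → level x ≤ n → ¬ Φ σ x
    below x≤n Φx = n≮n n (subst (_≤ n) (level-Φ Φx) x≤n)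

    n≤⇒Φ : ∀ {x} → n ≤ L.level x → Φ σ′ x
    n≤⇒Φ {x} n≤x with Φ? σ′ x
    ... | yes Φ′x = Φ′x
    ... | no ¬Φ′x = ⊥-elim (n≮n n (≤-<-trans n≤x (L.level-¬Φ ¬Φ′x)))

    n≤⇒n≤ : ∀ {x} → n ≤ level x → n ≤ L.level x
    n≤⇒n≤ {x} n≤x with Φ? σ x
    ... | yes Φx = ≤-reflexive (sym (L.level-Φ (Φ-contracted σ s t s≢t Φx)))
    ... | no _   = n≤x

    module _ {v} (v<n : L.level v < n) (level-v : level v ≡ L.level v) where

      ≤⇒≤ : ∀ {x} → level v ≤ level x → L.level v ≤ L.level x
      ≤⇒≤ {x} v≤x with Φ? σ x
      ... | yes Φx = ≤-trans (<⇒≤ v<n) (≤-reflexive (sym (L.level-Φ (Φ-contracted σ s t s≢t Φx))))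
      ... | no _   = subst (_≤ L.level x) level-v v≤x

      agree : ∀ {x} → level x ≤ level v → level x ≡ L.level x
      agree x≤v = level-¬Φ (below (≤-trans x≤v (subst (_≤ n) (sym level-v) (<⇒≤ v<n))))

      agree-cell : ∀ {x} → level x ≤ level v → cell x ≡ L.cell x
      agree-cell {x} x≤v = cell-¬Φ λ Φ′x → n≮n n (≤-<-trans
        (≤-trans (≤-reflexive (sym (L.level-Φ Φ′x))) (subst₂ _≤_ (agree x≤v) level-v x≤v)) v<n)

      lift-arrival : Arrival L.level L.cell v → Arrival level cell v
      lift-arrival a = record
        { parts = A.parts ; before = A.before ; s = A.s ; t = A.t ; distinct = A.distinct
        ; red≤d = A.red≤d
        ; level≡ = trans level-v A.level≡
        ; arrived = A.arrived ∘ ≤⇒≤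
        ; ahead = λ x<v → A.ahead (subst₂ _<_ (agree (<⇒≤ x<v)) level-v x<v)
        ; same-level = λ eq → let ¬Φx , cel = A.same-level
                                    (trans (sym (agree (≤-reflexive eq))) (trans eq level-v))
                              in ¬Φx , trans (agree-cell (≤-reflexive eq)) cel
        ; ahead-cell = λ {x} {y} x<v eq →
            let lev , cel = A.ahead-cell (subst₂ _<_ (agree (<⇒≤ x<v)) level-v x<v) eq
                y<v : L.level y < L.level v
                y<v = subst (_< L.level v) lev (subst₂ _<_ (agree (<⇒≤ x<v)) level-v x<v)
                ¬Φ′y : ¬ Φ σ′ y
                ¬Φ′y Φ′y = n≮n n (≤-<-trans (≤-reflexive (sym (L.level-Φ Φ′y))) (<-trans y<v v<n))
            in trans (agree (<⇒≤ x<v)) (trans lev (sym (level-¬Φ (¬Φ-before ¬Φ′y)))) ,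
               trans (agree-cell (<⇒≤ x<v)) (trans cel (sym (cell-¬Φ ¬Φ′y)))
        }
        where module A = Arrival a

      lift-never : Never L.level L.cell v → Never level cell v
      lift-never a = record
        { parts = A.parts ; final = A.final ; parts≤1 = A.parts≤1
        ; ahead = λ x≤v → A.ahead (subst₂ _≤_ (agree x≤v) level-v x≤v)
        }
        where module A = Never a

    first-time : ∀ v → ¬ Φ σ v → Arrival level cell v ⊎ Never level cell v
    first-time v ¬Φv with Φ? σ′ v
    ... | yes Φ′v = inj₁ record
      { parts = n ; before = σ ; s = s ; t = t ; distinct = s≢t
      ; red≤d = red≤d′
      ; level≡ = level-v
      ; arrived = λ v≤x → n≤⇒Φ (n≤⇒n≤ (subst (_≤ _) level-v v≤x))
      ; ahead = λ x<v → unarrived (subst (_ <_) level-v x<v)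
      ; same-level = λ eq → below (≤-reflexive (trans eq level-v)) ,
          cell-Φ (n≤⇒Φ (n≤⇒n≤ (≤-reflexive (sym (trans eq level-v)))))
      ; ahead-cell = λ {x} {y} x<v eq →
          let ¬Φ′x = unarrived (subst (_ <_) level-v x<v)
              ¬Φ′y = ¬Φ′x ∘ Φ-part σ′ (sym eq)
              lev , cel = L.same-part ¬Φ′x eq
          in trans (level-¬Φ (¬Φ-before ¬Φ′x)) (trans lev (sym (level-¬Φ (¬Φ-before ¬Φ′y)))) ,
             trans (cell-¬Φ ¬Φ′x) (trans cel (sym (cell-¬Φ ¬Φ′y)))
      }
      where
      level-v : level v ≡ n
      level-v = trans (level-¬Φ ¬Φv) (L.level-Φ Φ′v)

      unarrived : ∀ {x} → level x < n → ¬ Φ σ′ x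
      unarrived x<n Φ′x = n≮n n (≤-<-trans (≤-trans (≤-reflexive (sym (L.level-Φ Φ′x))) level-mono) x<n)
    ... | no ¬Φ′v with L.first-time v ¬Φ′v
    ...   | inj₁ a = inj₁ (lift-arrival (L.level-¬Φ ¬Φ′v) (level-¬Φ ¬Φv) a)
    ...   | inj₂ a = inj₂ (lift-never (L.level-¬Φ ¬Φ′v) (level-¬Φ ¬Φv) a)

    extended : Levels σ
    extended = record
      { level = level
      ; cell  = cell
      ; level≤ = level≤
      ; cell≤ = cell≤
      ; level-Φ = level-Φ
      ; level-¬Φ = λ {x} ¬Φx → subst (_< suc n) (sym (level-¬Φ ¬Φx)) (s≤s (L.level≤ x))
      ; same-part = same-part
      ; first-time = first-time
      }

  abstract
    levels : (σ : Stage G n) → ContractionSequence d (tri σ) → Levels σ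
    levels σ (step _ s t s≢t seq) =
      Extend.extended σ s t s≢t (redDegree-bound seq) (levels (contracted s t s≢t σ) seq)
    levels {n} σ (stop n≤1 _) = record
      { level = level
      ; cell  = λ _ → 0
      ; level≤ = level≤
      ; cell≤ = λ _ → z≤n
      ; level-Φ = level-Φ
      ; level-¬Φ = λ {x} ¬Φx → subst (_< n) (sym (level-¬Φ ¬Φx)) (nonempty x)
      ; same-part = λ {x} {y} ¬Φx eq →
          trans (level-¬Φ ¬Φx) (sym (level-¬Φ (¬Φx ∘ Φ-part σ (sym eq)))) , refl
      ; first-time = λ v ¬Φv → inj₂ record
          { parts = n ; final = σ ; parts≤1 = n≤1
          ; ahead = λ {x} x≤v Φx → n≮n 0 (<-≤-trans (nonempty x)
              (subst₂ _≤_ (level-Φ Φx) (level-¬Φ ¬Φv) x≤v)) }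
      }
      where
      level : Vertex G → ℕ
      level x = if does (Φ? σ x) then n else 0

      nonempty : Vertex G → 0 < n
      nonempty x = ≤-<-trans z≤n (Fin.toℕ<n (part σ x))

      level-Φ : ∀ {x} → Φ σ x → level x ≡ n
      level-Φ {x} Φx with Φ? σ x
      ... | yes _  = refl
      ... | no ¬Φx = ⊥-elim (¬Φx Φx)

      level-¬Φ : ∀ {x} → ¬ Φ σ x → level x ≡ 0
      level-¬Φ {x} ¬Φx with Φ? σ x
      ... | yes Φx = ⊥-elim (¬Φx Φx)
      ... | no _   = refl

      level≤ : ∀ x → level x ≤ n
      level≤ x with Φ? σ x
      ... | yes _ = ≤-refl
      ... | no _  = z≤n

-- Auxiliary lists, selections and bicliques

elements : (X : Subset n) → ∃[ xs ] length xs ≤ ∣ X ∣ × (∀ {x} → x ∈ X → x ∈ˡ xs)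
elements Vec.[] = [] , z≤n , λ ()
elements (b Vec.∷ X) with elements X
elements (false Vec.∷ X) | xs , xs≤ , all =
  List.map suc xs , ≤-trans (≤-reflexive (length-map suc xs)) xs≤ ,
  λ { (Vec.there x∈) → ∈-map⁺ suc (all x∈) }
elements (true Vec.∷ X) | xs , xs≤ , all =
  zero ∷ List.map suc xs , s≤s (≤-trans (≤-reflexive (length-map suc xs)) xs≤) ,
  λ { Vec.here → here refl ; (Vec.there x∈) → there (∈-map⁺ suc (all x∈)) }

redNeighbours : (t : Trigraph n) → (∀ q → redDegree t q ≤ d) → ∀ q →
  ∃[ qs ] length qs ≤ d × (∀ {r} → edge t q r ≡ red → r ∈ˡ qs)
redNeighbours t red≤d q with elements (Vec.tabulate (λ r → isRed (edge t q r)))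
... | qs , qs≤ , all = qs , ≤-trans qs≤ (red≤d q) , λ {r} eq →
  all (lookup⇒[]= r _ (trans (lookup∘tabulate _ r) (cong isRed eq)))

length-filter-mono : {P Q : Pred A 0ℓ} (P? : Decidable P) (Q? : Decidable Q) →
  (∀ {x} → P x → Q x) → ∀ xs → length (filter P? xs) ≤ length (filter Q? xs)
length-filter-mono P? Q? P⇒Q []       = z≤n
length-filter-mono P? Q? P⇒Q (x ∷ xs) with P? x | Q? x
... | yes _ | yes _  = s≤s (length-filter-mono P? Q? P⇒Q xs)
... | yes p | no ¬q  = ⊥-elim (¬q (P⇒Q p))
... | no _  | yes _  = m≤n⇒m≤1+n (length-filter-mono P? Q? P⇒Q xs)
... | no _  | no _   = length-filter-mono P? Q? P⇒Q xs

select : {P : Pred (Fin n) 0ℓ} (P? : Decidable P) → k ≤ length (filter P? (allFin n)) →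
         Σ (Fin k → Fin n) λ f → Injective _≡_ _≡_ f × (∀ i → P (f i))
select {n = n} P? k≤ =
  (λ i → List.lookup (filter P? (allFin n)) (inject≤ i k≤)) ,
  (λ eq → Fin.inject≤-injective k≤ k≤ _ _
            (lookup-injective (Unique.filter⁺ P? (Unique.allFin⁺ n)) eq)) ,
  λ i → proj₂ (∈-filter⁻ P? {xs = allFin n} (∈-lookup (inject≤ i k≤)))

isBlack? : ∀ e → Dec (e ≡ black)
isBlack? none  = no λ ()
isBlack? black = yes refl
isBlack? red   = no λ ()

-- The two sides are disjoint automatically, since adjacency is irreflexive.
Biclique : ℕ → ℕ → Graph → Set
Biclique a b G =
  Σ (Fin a → Vertex G) λ f → Σ (Fin b → Vertex G) λ g →
  Injective _≡_ _≡_ f × Injective _≡_ _≡_ g × (∀ i j → Adjacent G (f i) (g j))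


-- Graphs of bounded twin-width without large bicliques

-- Order the vertices by the time at which their part reaches size s, the
-- last ones first.  When the part of v has just reached size s, a walk
-- through vertices above v stays in parts of size at least s, each of
-- which has at most d red and fewer than s black neighbours; so it
-- meets few parts, and the vertices below v lie in parts smaller than s.
module SparseOrder (G : Graph) {d s : ℕ} (2≤s : 2 ≤ s) (sparse : ¬ Biclique s s G)
                   (seq : ContractionSequence d (fromGraph G)) where

  inPart? : (σ : Stage G n) (q : Fin n) → Decidable (λ y → part σ y ≡ q)
  inPart? σ q y = part σ y Fin.≟ q

  partMembers : Stage G n → Fin n → List (Vertex G)
  partMembers σ q = filter (inPart? σ q) (allFin _)

  BigPart : Stage G n → Fin n → Set
  BigPart σ q = s ≤ length (partMembers σ q)

  Big : Stage G n → Vertex G → Set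
  Big σ x = BigPart σ (part σ x)

  Big-contracted : (σ : Stage G (suc n)) (u v : Fin (suc n)) (u≢v : u ≢ v) →
                   ∀ {x} → Big σ x → Big (contracted u v u≢v σ) x
  Big-contracted σ u v u≢v {x} big = ≤-trans big
    (length-filter-mono (inPart? σ _) (inPart? (contracted u v u≢v σ) _)
      (cong (collapse u v u≢v)) (allFin _))

  open FirstTime G d Big (λ σ x → s ≤? length (partMembers σ (part σ x)))
    (λ σ eq → subst (BigPart σ) eq) Big-contracted

  -- Big parts yield the empty list, so the length bound `s` holds for every part.
  smallPart : Stage G n → Fin n → List (Vertex G)
  smallPart σ q with s ≤? length (partMembers σ q)
  ... | yes _ = []
  ... | no _  = partMembers σ q

  length-smallPart : (σ : Stage G n) → ∀ q → length (smallPart σ q) ≤ s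
  length-smallPart σ q with s ≤? length (partMembers σ q)
  ... | yes _   = z≤n
  ... | no s≰q  = <⇒≤ (≰⇒> s≰q)

  ∈-smallPart : (σ : Stage G n) → ∀ {x} → ¬ Big σ x → x ∈ˡ smallPart σ (part σ x)
  ∈-smallPart σ {x} ¬big with s ≤? length (partMembers σ (part σ x))
  ... | yes big = ⊥-elim (¬big big)
  ... | no _    = ∈-filter⁺ (inPart? σ (part σ x)) (∈-allFin x) refl

  module _ (σ : Stage G n) (red≤d : ∀ q → redDegree (tri σ) q ≤ d) where

    blackTo? : ∀ q → Decidable (λ y → edge (tri σ) q (part σ y) ≡ black)
    blackTo? q y = isBlack? (edge (tri σ) q (part σ y))

    blackNeighbours : Fin n → List (Vertex G)
    blackNeighbours q = filter (blackTo? q) (allFin _)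

    big⇒few-black : ∀ {q} → BigPart σ q → length (blackNeighbours q) ≤ s
    big⇒few-black {q} big with s ≤? length (blackNeighbours q)
    ... | no s≰  = <⇒≤ (≰⇒> s≰)
    ... | yes s≤ with select (inPart? σ q) big | select (blackTo? q) s≤
    ...   | f , f-inj , f-part | g , g-inj , g-black =
      ⊥-elim (sparse (f , g , f-inj , g-inj , λ i j → black⇒adjacent σ (f i) (g j)
        (trans (cong (λ q → edge (tri σ) q (part σ (g j))) (f-part i)) (g-black j))))

    neighbourParts : ∀ q → ∃[ qs ] length qs ≤ suc (d + s) × q ∈ˡ qs ×
      (∀ {x y} → part σ x ≡ q → Big σ x → Adjacent G x y → part σ y ∈ˡ qs)
    neighbourParts q with s ≤? length (partMembers σ q)
    ... | no s≰ = q ∷ [] , s≤s z≤n , here refl ,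
      λ { refl big → ⊥-elim (s≰ big) }
    ... | yes big with redNeighbours (tri σ) red≤d q
    ...   | reds , reds≤d , red∈ =
      q ∷ reds ++ List.map (part σ) (blackNeighbours q) ,
      s≤s (≤-trans (≤-reflexive (length-++ reds)) (+-mono-≤ reds≤d
        (≤-trans (≤-reflexive (length-map (part σ) (blackNeighbours q))) (big⇒few-black big)))) ,
      here refl , λ { {x} {y} refl _ xy → complete x y xy refl }
      where
      complete : ∀ x y → Adjacent G x y → part σ x ≡ q →
                 part σ y ∈ˡ q ∷ reds ++ List.map (part σ) (blackNeighbours q)
      complete x y xy refl with part σ y Fin.≟ part σ x
      ... | yes same = here same
      ... | no differ with edge (tri σ) (part σ x) (part σ y) in eq
      ...   | none  = ⊥-elim (none⇒¬adjacent σ x y (differ ∘ sym) eq xy)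
      ...   | red   = there (∈-++⁺ˡ (red∈ eq))
      ...   | black = there (∈-++⁺ʳ reds (∈-map⁺ (part σ) (∈-filter⁺ (blackTo? _) (∈-allFin y) eq)))

    nearParts : ℕ → Fin n → List (Fin n)
    nearParts zero    q = q ∷ []
    nearParts (suc k) q = concatMap (nearParts k) (proj₁ (neighbourParts q))

    length-nearParts : ∀ k q → length (nearParts k q) ≤ suc (d + s) ^ k
    length-nearParts zero    q = ≤-refl
    length-nearParts (suc k) q =
      ≤-trans (length-concatMap-≤ (nearParts k) (length-nearParts k) (proj₁ (neighbourParts q)))
              (*-monoˡ-≤ _ (proj₁ (proj₂ (neighbourParts q))))

    self∈nearParts : ∀ k q → q ∈ˡ nearParts k q
    self∈nearParts zero    q = here refl
    self∈nearParts (suc k) q =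
      ∈-concatMap (nearParts k) (proj₁ (proj₂ (proj₂ (neighbourParts q)))) (self∈nearParts k q)

    walk∈nearParts : ∀ {k l a x y} → l < k → Walk (Adjacent G) (Big σ) l a x → Adjacent G x y →
                     part σ y ∈ˡ nearParts k (part σ a)
    walk∈nearParts {suc k} _ (here big) xy = ∈-concatMap (nearParts k)
      (proj₂ (proj₂ (proj₂ (neighbourParts _))) refl big xy) (self∈nearParts k _)
    walk∈nearParts {suc k} (s≤s l<k) (step big ab w) xy = ∈-concatMap (nearParts k)
      (proj₂ (proj₂ (proj₂ (neighbourParts _))) refl big ab) (walk∈nearParts l<k w xy)

  open Levels (levels (initial G) seq)

  -- Lexicographic: the level dominates, and the vertex itself breaks ties so that the order is
  -- injective.
  rank : Vertex G → Fin (suc (order G) * order G)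
  rank v = combine (fromℕ< (s≤s (level≤ v))) v

  ρ : Vertex G → ℕ
  ρ v = toℕ (rank v)

  ρ-injective : Injective _≡_ _≡_ ρ
  ρ-injective {x} {y} eq = Fin.combine-injectiveʳ
    (fromℕ< (s≤s (level≤ x))) x (fromℕ< (s≤s (level≤ y))) y (Fin.toℕ-injective eq)

  ρ≤⇒level≤ : ∀ {u v} → ρ u ≤ ρ v → level u ≤ level v
  ρ≤⇒level≤ {u} {v} u≤v = ≮⇒≥ λ v<u → <⇒≱ (Fin.combine-monoˡ-< v u
    (subst₂ _<_ (sym (Fin.toℕ-fromℕ< (s≤s (level≤ v)))) (sym (Fin.toℕ-fromℕ< (s≤s (level≤ u)))) v<u))
    u≤v

  -- Initial parts are singletons. Thus every vertex has a first time of becoming big, or never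
  -- becomes big.
  initially-small : ∀ v → ¬ Big (initial G) v
  initially-small v big with select (inPart? (initial G) v) (≤-trans 2≤s big)
  ... | f , f-inj , f≡v with () ← f-inj {zero} {suc zero} (trans (f≡v zero) (sym (f≡v (suc zero))))

  -- The product counts the vertices of small parts near that of `v`; `s + s` counts the two parts
  -- just contracted.
  strongBound : ℕ → ℕ
  strongBound r = suc (d + s) ^ r * s + (s + s)

  strongReach : ∀ r → StrongReachBound G ρ r (strongBound r)
  strongReach r v with first-time v (initially-small v)
  -- If the part of `v` never becomes big, neither does that of any lower vertex, and the only final
  -- part contains them all.
  ... | inj₂ never = smallPart final (part final v) ,
    ≤-trans (length-smallPart final _) (≤-trans (m≤m+n s s) (m≤n+m (s + s) (suc (d + s) ^ r * s))) ,
    λ {x} {y} _ _ _ y<v → subst (λ q → y ∈ˡ smallPart final q) (onePart y v)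
      (∈-smallPart final (ahead (ρ≤⇒level≤ (<⇒≤ y<v))))
    where
    open Never never
    onePart : ∀ x y → part final x ≡ part final y
    onePart x y = Fin.toℕ-injective (trans (only x) (sym (only y)))
      where
      only : ∀ x → toℕ (part final x) ≡ 0
      only x = n≤0⇒n≡0 (≤-pred (≤-trans (Fin.toℕ<n (part final x)) parts≤1))
  ... | inj₁ arrival = old ++ new ,
    ≤-trans (≤-reflexive (length-++ old)) (+-mono-≤ length-old length-new) , reach
    where
    open Arrival arrival renaming (s to s₁; t to s₂)
    near = nearParts after red≤d r (part after v)
    old = concatMap (smallPart after) near
    new = smallPart before s₁ ++ smallPart before s₂

    length-old : length old ≤ suc (d + s) ^ r * s
    length-old = ≤-trans (length-concatMap-≤ (smallPart after) (length-smallPart after) near)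
                         (*-monoˡ-≤ s (length-nearParts after red≤d r (part after v)))

    length-new : length new ≤ s + s
    length-new = ≤-trans (≤-reflexive (length-++ (smallPart before s₁)))
                         (+-mono-≤ (length-smallPart before s₁) (length-smallPart before s₂))

    unchanged : ∀ {y} → part before y ≢ s₁ → part before y ≢ s₂ → Big after y → Big before y
    unchanged {y} ≢s₁ ≢s₂ big = ≤-trans big
      (length-filter-mono (inPart? after _) (inPart? before _)
        (λ eq → sym (collapse-injective s₁ s₂ distinct (sym eq) ≢s₁ ≢s₂)) (allFin _))

    newlyBig : ∀ {y} → ¬ Big before y → Big after y → y ∈ˡ new
    newlyBig {y} ¬big big with part before y Fin.≟ s₁ | part before y Fin.≟ s₂
    ... | yes eq | _      = ∈-++⁺ˡ (subst (λ q → y ∈ˡ smallPart before q) eq (∈-smallPart before ¬big))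
    ... | no _   | yes eq = ∈-++⁺ʳ (smallPart before s₁)
                              (subst (λ q → y ∈ˡ smallPart before q) eq (∈-smallPart before ¬big))
    ... | no ≢s₁ | no ≢s₂ = ⊥-elim (¬big (unchanged ≢s₁ ≢s₂ big))

    reach : ∀ {x y l} → l < r → Walk (Adjacent G) (λ z → ρ v ≤ ρ z) l v x → Adjacent G x y →
            ρ y < ρ v → y ∈ˡ old ++ new
    -- At equal levels `y` became big together with `v`, so it comes from a contracted part that was
    -- small before. At a smaller level it still lies in a small part, close to `part after v`
    -- because the walk runs through big parts.
    reach {x} {y} l<r w xy y<v with level y ≟ level v
    ... | yes same = ∈-++⁺ʳ old (newlyBig (proj₁ (same-level same)) (arrived (≤-reflexive (sym same))))
    ... | no other = ∈-++⁺ˡ (∈-concatMap (smallPart after)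
      (walk∈nearParts after red≤d l<r (walk-weaken (arrived ∘ ρ≤⇒level≤) w) xy)
      (∈-smallPart after (ahead (≤∧≢⇒< (ρ≤⇒level≤ (<⇒≤ y<v)) other))))

-- With b the bound on strong reach, weak reach is at most (b + 1)^r, and greedy colouring needs one
-- colour more.
sparseColours : (p d s : ℕ) → ℕ
sparseColours p d s = suc (suc (suc (d + s) ^ r * s + (s + s)) ^ r)
  where r = shortLength p

sparse⇒centred : ∀ p (G : Graph) {d s} → 2 ≤ s → ¬ Biclique s s G →
  ContractionSequence d (fromGraph G) → CentredColouring p G (sparseColours p d s)
sparse⇒centred p G 2≤s sparse seq =
  strongReach⇒centred G ρ ρ-injective p (strongReach (shortLength p))
  where open SparseOrder G 2≤s sparse seq

-- χ-boundedness of graphs of bounded twin-width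

Clique : (G : Graph) → Subset (order G) → ℕ → Set
Clique G S m = Σ (Fin m → Vertex G) λ f →
  (∀ i → f i ∈ S) × (∀ i j → i ≢ j → Adjacent G (f i) (f j))

Clique-∷ : (G : Graph) {S S′ : Subset (order G)} → (∀ {x} → x ∈ S′ → x ∈ S) →
           ∀ {z} → z ∈ S → ((f , _) : Clique G S′ m) → (∀ i → Adjacent G (f i) z) →
           Clique G S (suc m)
Clique-∷ G {S} S′⊆S {z} z∈S (f , f∈ , f-adj) f-z = g , g∈ , g-adj
  where
  g : Fin _ → Vertex G
  g zero    = z
  g (suc i) = f i

  g∈ : ∀ i → g i ∈ S
  g∈ zero    = z∈S
  g∈ (suc i) = S′⊆S (f∈ i)

  g-adj : ∀ i j → i ≢ j → Adjacent G (g i) (g j)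
  g-adj zero    zero    i≢j = ⊥-elim (i≢j refl)
  g-adj zero    (suc j) _   = Adjacent-sym G (f-z j)
  g-adj (suc i) zero    _   = f-z i
  g-adj (suc i) (suc j) i≢j = f-adj i j (i≢j ∘ cong suc)

-- Call a part alive while it has a black neighbour meeting S, and let
-- the cells be the parts at their last live stage.  A cell has smaller
-- clique number than S.  A part that has just died has at most d
-- adjacent parts, and each of these contains at most three cells dying
-- no earlier.
module Cells (G : Graph) {d : ℕ} (seq : ContractionSequence d (fromGraph G))
             (S : Subset (order G)) where

  Dead : Stage G n → Vertex G → Set
  Dead σ x = ∀ y → y ∈ S → edge (tri σ) (part σ x) (part σ y) ≢ black

  open FirstTime G d Dead
    (λ σ x → Fin.all? λ y → (y ∈? S) →-dec ¬? (isBlack? (edge (tri σ) (part σ x) (part σ y))))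
    (λ σ eq dead y → subst (λ q → edge (tri σ) q (part σ y) ≢ black) eq ∘ dead y)
    (λ σ u v u≢v dead y y∈S black′ →
       dead y y∈S (contract-black u v u≢v (tri σ) (part σ _) (part σ y) black′))

  dead? : ∀ v → Dec (Dead (initial G) v)
  dead? v = Fin.all? λ y → (y ∈? S) →-dec ¬? (isBlack? (edge (fromGraph G) v y))

  open Levels (levels (initial G) seq)

  N = order G

  Key : Set
  Key = Fin (suc N * suc N)

  mkKey : ∀ {a b} → a ≤ N → b ≤ N → Key
  mkKey a≤N b≤N = combine (fromℕ< (s≤s a≤N)) (fromℕ< (s≤s b≤N))

  mkKey-cong : ∀ {a b a′ b′} (a≤ : a ≤ N) (b≤ : b ≤ N) (a≤′ : a′ ≤ N) (b≤′ : b′ ≤ N) →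
               a ≡ a′ → b ≡ b′ → mkKey a≤ b≤ ≡ mkKey a≤′ b≤′
  mkKey-cong a≤ b≤ a≤′ b≤′ refl refl =
    cong₂ mkKey (≤-irrelevant a≤ a≤′) (≤-irrelevant b≤ b≤′)

  key : Vertex G → Key
  key v = mkKey (level≤ v) (cell≤ v)

  key-injective : ∀ {u v} → key u ≡ key v → level u ≡ level v × cell u ≡ cell v
  key-injective {u} {v} eq
    with Fin.combine-injective (fromℕ< (s≤s (level≤ u))) (fromℕ< (s≤s (cell≤ u)))
                               (fromℕ< (s≤s (level≤ v))) (fromℕ< (s≤s (cell≤ v))) eq
  ... | lev , cel = Fin.fromℕ<-injective _ _ _ _ lev , Fin.fromℕ<-injective _ _ _ _ cel

  key<⇒level≤ : ∀ {u v} → toℕ (key u) < toℕ (key v) → level u ≤ level v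
  key<⇒level≤ {u} {v} u<v = ≮⇒≥ λ v<u → <-asym u<v
    (Fin.combine-monoˡ-< (fromℕ< (s≤s (cell≤ v))) (fromℕ< (s≤s (cell≤ u)))
      (subst₂ _<_ (sym (Fin.toℕ-fromℕ< (s≤s (level≤ v)))) (sym (Fin.toℕ-fromℕ< (s≤s (level≤ u)))) v<u))

  dead-isolated : ∀ {u v} → Dead (initial G) v → u ∈ S → ¬ Adjacent G v u
  dead-isolated dead u∈S vu = dead _ u∈S (initial-black G vu)

  -- A trigraph with at most one part has no black edge, so every part dies eventually.
  arrival : ∀ {v} → ¬ Dead (initial G) v → Arrival level cell v
  arrival {v} alive with first-time v alive
  ... | inj₁ arr   = arr
  ... | inj₂ never = ⊥-elim (ahead ≤-refl λ y _ → irreflexive y)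
    where
    open Never never
    single : ∀ x → toℕ (part final x) ≡ 0
    single x = n≤0⇒n≡0 (≤-pred (≤-trans (Fin.toℕ<n (part final x)) parts≤1))

    irreflexive : ∀ y → edge (tri final) (part final v) (part final y) ≢ black
    irreflexive y isBlack
      with () ← trans (sym (Trigraph.edge-irrefl (tri final) (part final v)))
                      (trans (cong (edge (tri final) (part final v))
                                   (Fin.toℕ-injective (trans (single v) (sym (single y)))))
                             isBlack)

  module _ {v : Vertex G} (arr : Arrival level cell v) where
    open Arrival arr

    same-key : ∀ {x} → key x ≡ key v → part before x ≡ part before v
    same-key eq with key-injective eq
    ... | lev , cel = Fin.toℕ-injective
      (trans (sym (proj₂ (same-level lev))) (trans cel (proj₂ (same-level refl))))

    parts≤N : parts ≤ N
    parts≤N = subst (_≤ N) level≡ (level≤ v)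

    cell-bound : (q : Fin (suc parts)) → toℕ q ≤ N
    cell-bound q = ≤-trans (≤-pred (Fin.toℕ<n q)) parts≤N

    newKey : Fin (suc parts) → Key
    newKey q = mkKey parts≤N (cell-bound q)

    older? : ∀ q → Dec (∃[ x ] part after x ≡ q × level x < level v)
    older? q = Fin.any? λ x → (part after x Fin.≟ q) ×-dec (level x <? level v)

    olderKey : Fin parts → Key
    olderKey q with older? q
    ... | yes (x , _) = key x
    -- Placeholder: no vertex of smaller level lies in `q`.
    ... | no _        = key v

    olderKey-part : ∀ {u} → level u < level v → key u ≡ olderKey (part after u)
    olderKey-part {u} u<v with older? (part after u)
    ... | no none-older = ⊥-elim (none-older (u , refl , u<v))
    ... | yes (x , same , _) with ahead-cell u<v (sym same)
    ...   | lev , cel = mkKey-cong (level≤ u) (cell≤ u) (level≤ x) (cell≤ x) lev cel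

    -- Vertices dying in this very contraction have their former part as cell: the part that keeps
    -- its place, or the deleted part `t`. Those in `q` still alive share one part, hence one future
    -- key.
    keysIn : Fin parts → List Key
    keysIn q = newKey (punchIn t q) ∷ newKey t ∷ olderKey q ∷ []

    newKey-part : ∀ {u q} → level u ≡ level v → part before u ≡ q → key u ≡ newKey q
    newKey-part {u} {q} same eq = mkKey-cong (level≤ u) (cell≤ u) parts≤N (cell-bound q) (trans same level≡)
      (trans (proj₂ (same-level same)) (cong toℕ eq))

    key∈keysIn : ∀ {u} → level u ≤ level v → key u ∈ˡ keysIn (part after u)
    key∈keysIn {u} u≤v with level u ≟ level v
    ... | no u≢v   = there (there (here (olderKey-part (≤∧≢⇒< u≤v u≢v))))
    ... | yes same with collapse-preimage s t distinct {part before u}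
    ...   | inj₁ ≡t  = there (here (newKey-part same ≡t))
    ...   | inj₂ ≡in = here (newKey-part same ≡in)

  laterNeighbours : ∀ k → ∃[ ks ] length ks ≤ suc d * 3 × (∀ {u v} → u ∈ S → v ∈ S →
    key v ≡ k → Adjacent G v u → toℕ (key u) < toℕ k → key u ∈ˡ ks)
  laterNeighbours k with Fin.any? (λ v → key v Fin.≟ k)
  ... | no unused = [] , z≤n , λ {_} {v} _ _ eq _ _ → ⊥-elim (unused (v , eq))
  ... | yes (v₀ , refl) with dead? v₀
  -- Only vertices dead from the start have level `N`, and these have no neighbour in `S`.
  ...   | yes dead = [] , z≤n , λ {_} {v} u∈S _ eq vu _ → ⊥-elim
    (n≮n N (subst (_< N) (trans (proj₁ (key-injective eq)) (level-Φ dead))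
      (level-¬Φ λ dead′ → dead-isolated dead′ u∈S vu)))
  ...   | no alive with arrival alive
  ...     | arr with redNeighbours (tri (Arrival.after arr)) (Arrival.red≤d arr)
                                   (part (Arrival.after arr) v₀)
  ...       | reds , reds≤d , red∈ =
    concatMap (keysIn arr) (part after v₀ ∷ reds) ,
    ≤-trans (length-concatMap-≤ (keysIn arr) (λ _ → ≤-refl) (part after v₀ ∷ reds))
            (*-monoˡ-≤ 3 (s≤s reds≤d)) ,
    λ {u} {v} u∈S _ eq vu u<v → ∈-concatMap (keysIn arr)
      (adjacentPart (cong (collapse s t distinct) (same-key arr eq)) u∈S vu)
      (key∈keysIn arr (key<⇒level≤ u<v))
    where
    open Arrival arr
    adjacentPart : ∀ {u v} → part after v ≡ part after v₀ → u ∈ S → Adjacent G v u →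
                   part after u ∈ˡ part after v₀ ∷ reds
    adjacentPart {u} {v} eq u∈S vu with part after u Fin.≟ part after v₀
    ... | yes same  = here same
    ... | no differ with edge (tri after) (part after v₀) (part after u) in e
    ...   | red   = there (red∈ e)
    ...   | black = ⊥-elim (arrived ≤-refl u u∈S e)
    ...   | none  = ⊥-elim (none⇒¬adjacent after v u (differ ∘ sym ∘ trans (sym eq))
                      (trans (cong (λ q → edge (tri after) q (part after u)) eq) e) vu)

  cellColouring : Σ (Key → Fin (suc (suc d * 3))) λ c → ∀ {u v} → u ∈ S → v ∈ S →
                  Adjacent G u v → key u ≢ key v → c (key u) ≢ c (key v)
  cellColouring with greedy toℕ (λ k → proj₁ (laterNeighbours k))
                       (λ k → proj₁ (proj₂ (laterNeighbours k))) (suc N * suc N)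
  ... | c , good = c , proper
    where
    proper : ∀ {u v} → u ∈ S → v ∈ S → Adjacent G u v → key u ≢ key v → c (key u) ≢ c (key v)
    proper {u} {v} u∈S v∈S uv differ with <-cmp (toℕ (key u)) (toℕ (key v))
    ... | tri< u<v _ _ =
      good (proj₂ (proj₂ (laterNeighbours _)) u∈S v∈S refl (Adjacent-sym G uv) u<v) u<v
           (Fin.toℕ<n (key v))
    ... | tri≈ _ same _ = ⊥-elim (differ (Fin.toℕ-injective same))
    ... | tri> _ _ v<u = good (proj₂ (proj₂ (laterNeighbours _)) v∈S u∈S refl uv v<u) v<u
                              (Fin.toℕ<n (key u)) ∘ sym

  cellSet : Key → Subset (order G)
  cellSet k = S ∩ Vec.tabulate (λ x → does (key x Fin.≟ k))

  ∈-cellSet⁻ : ∀ {k x} → x ∈ cellSet k → x ∈ S × key x ≡ k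
  ∈-cellSet⁻ {k} {x} x∈ with x∈p∩q⁻ S _ x∈
  ... | x∈S , x∈cell with key x Fin.≟ k | trans (sym (lookup∘tabulate (λ x → does (key x Fin.≟ k)) x)) ([]=⇒lookup x∈cell)
  ...   | yes eq | _ = x∈S , eq

  ∈-cellSet⁺ : ∀ {x} → x ∈ S → x ∈ cellSet (key x)
  ∈-cellSet⁺ {x} x∈S = x∈p∩q⁺ (x∈S , lookup⇒[]= x _
    (trans (lookup∘tabulate _ x) (dec-true (key x Fin.≟ key x) refl)))

  -- The neighbour `u` keeps `v` alive at first, so the cell of `v` had a black neighbour containing
  -- some `z` in `S`. This `z` is adjacent to the whole cell and extends each of its cliques.
  smaller-clique : ∀ {u v} → u ∈ S → Adjacent G v u → ¬ Clique G S (suc m) →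
                   ¬ Clique G (cellSet (key v)) m
  smaller-clique {v = v} u∈S vu no-clique clique@(f , f∈ , _) =
    proj₁ (same-level refl) λ z z∈S isBlack → no-clique
      (Clique-∷ G (proj₁ ∘ ∈-cellSet⁻) z∈S clique λ i → black⇒adjacent before (f i) z
        (trans (cong (λ q → edge (tri before) q (part before z))
                     (same-key arr (proj₂ (∈-cellSet⁻ (f∈ i)))))
               isBlack))
    where
    arr = arrival {v} λ dead → dead-isolated dead u∈S vu
    open Arrival arr

-- Each unit of clique size costs a factor 3(d + 1) + 1, the greedy bound for colouring the cells.
properColours : (d m : ℕ) → ℕ
properColours d zero    = 1
properColours d (suc m) = suc (suc d * 3) * properColours d m

-- The colouring precedes the hypothesis on cliques because a cell is known to have smaller cliques
-- only if one of its vertices has a neighbour in `S`; this becomes available at the edge being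
-- checked.
properColouring : (G : Graph) → ContractionSequence d (fromGraph G) → ∀ m S →
  Σ (Vertex G → Fin (properColours d m)) λ c → ¬ Clique G S m →
  ∀ {u v} → u ∈ S → v ∈ S → Adjacent G u v → c u ≢ c v
properColouring G seq zero S =
  (λ _ → zero) , λ no-clique → ⊥-elim (no-clique ((λ ()) , (λ ()) , λ ()))
properColouring {d} G seq (suc m) S = c , proper
  where
  open Cells G seq S

  inner : Key → Vertex G → Fin (properColours d m)
  inner k = proj₁ (properColouring G seq m (cellSet k))

  outer : Key → Fin (suc (suc d * 3))
  outer = proj₁ cellColouring

  c : Vertex G → Fin (properColours d (suc m))
  c v = combine (outer (key v)) (inner (key v) v)

  proper : ¬ Clique G S (suc m) → ∀ {u v} → u ∈ S → v ∈ S → Adjacent G u v → c u ≢ c v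
  proper no-clique {u} {v} u∈S v∈S uv eq = case key u Fin.≟ key v of λ
    { (no differ) → proj₂ cellColouring u∈S v∈S uv differ (proj₁ components≡)
    ; (yes same)  → proj₂ (properColouring G seq m (cellSet (key v)))
        (smaller-clique u∈S (Adjacent-sym G uv) no-clique)
        (subst (λ k → u ∈ cellSet k) same (∈-cellSet⁺ u∈S)) (∈-cellSet⁺ v∈S) uv
        (subst (λ k → inner k u ≡ inner (key v) v) same (proj₂ components≡))
    }
    where
    components≡ : outer (key u) ≡ outer (key v) × inner (key u) u ≡ inner (key v) v
    components≡ = Fin.combine-injective (outer (key u)) _ (outer (key v)) _ eq

-- Cliques as topological minors

complete : ℕ → Graph
complete n = record
  { order      = n
  ; adj        = λ u v → not (does (u Fin.≟ v))
  ; adj-sym    = symmetric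
  ; adj-irrefl = irreflexive
  }
  where
  symmetric : ∀ (u v : Fin n) → not (does (u Fin.≟ v)) ≡ not (does (v Fin.≟ u))
  symmetric u v with u Fin.≟ v | v Fin.≟ u
  ... | yes _   | yes _   = refl
  ... | no _    | no _    = refl
  ... | yes u≡v | no v≢u  = ⊥-elim (v≢u (sym u≡v))
  ... | no u≢v  | yes v≡u = ⊥-elim (u≢v (sym v≡u))

  irreflexive : ∀ (v : Fin n) → not (does (v Fin.≟ v)) ≡ false
  irreflexive v with v Fin.≟ v
  ... | yes _  = refl
  ... | no v≢v = ⊥-elim (v≢v refl)

complete-adjacent : ∀ {u v : Fin n} → u ≢ v → Adjacent (complete n) u v
complete-adjacent {u = u} {v} u≢v with u Fin.≟ v
... | yes u≡v = ⊥-elim (u≢v u≡v)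
... | no _    = tt

complete-cliqueNumber : ∀ n → IsCliqueNumber (complete n) n
complete-cliqueNumber n =
  (⊤ , (λ _ _ → complete-adjacent) , ∣⊤∣≡n n) , λ { j (X , _ , refl) → ∣p∣≤n X }

TM-complete-bound : ∀ {G} → IsClassCliqueNumber (TM p G) w → TM p G (complete m) → m ≤ w
TM-complete-bound {m = m} (bound , _) tm = bound (complete m) tm m (complete-cliqueNumber m)

Edge-≡ : ∀ {H} {e f : Edge H} → source e ≡ source f → target e ≡ target f → e ≡ f
Edge-≡ {e = mkEdge s t s<t st} {mkEdge .s .t s<t′ st′} refl refl =
  cong₂ (mkEdge s t) (≤-irrelevant s<t s<t′) (T-irrelevant st st′)

clique⇒TM : ∀ {G} (f : Fin m → Vertex G) → (∀ i j → i ≢ j → Adjacent G (f i) (f j)) →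
            TM p G (complete m)
clique⇒TM {m} {G = G} f f-adj = (λ _ → 0) , (λ _ → z≤n) , φ , φ-injective , hom
  where
  open Subdivision (complete m) (λ _ → 0) using (SubVertex; Link; original; subdividing; whole)

  φ : SubVertex → Vertex G
  φ (original v)       = f v
  φ (subdividing _ ())

  φ-injective : Injective _≡_ _≡_ φ
  φ-injective {original u} {original v} eq =
    cong original (decidable-stable (u Fin.≟ v) λ u≢v → Adjacent-irrefl G (f-adj u v u≢v) eq)

  link : ∀ {x y} → Link x y → Adjacent G (φ x) (φ y)
  link (whole e _) = f-adj _ _ (Adjacent-irrefl (complete m) (Edge.adjacent e))

  hom : ∀ {x y} → SubAdjacent (complete m) (λ _ → 0) x y → Adjacent G (φ x) (φ y)
  hom (fwd xy) = link xy
  hom (bwd yx) = Adjacent-sym G (link yx)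

-- The side `f` carries the branch vertices. Each pair of them owns a vertex of the side `g`, which
-- subdivides its edge; hence `m * m`.
biclique⇒TM : ∀ {G} → 1 ≤ p → Biclique m (m * m) G → TM p G (complete m)
biclique⇒TM {m = m} {G} 1≤p (f , g , f-inj , g-inj , fg) =
  (λ _ → 1) , (λ _ → 1≤p) , φ , φ-injective , hom
  where
  open Subdivision (complete m) (λ _ → 1)
    using (SubVertex; Link; original; subdividing; first; last; next)

  φ : SubVertex → Vertex G
  φ (original v)      = f v
  φ (subdividing e _) = g (combine (source e) (target e))

  φ-injective : Injective _≡_ _≡_ φ
  φ-injective {original u} {original v} eq = cong original (f-inj eq)
  φ-injective {original u} {subdividing e _} eq = ⊥-elim (Adjacent-irrefl G (fg u _) eq)
  φ-injective {subdividing e _} {original v} eq = ⊥-elim (Adjacent-irrefl G (fg v _) (sym eq))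
  φ-injective {subdividing e zero} {subdividing e′ zero} eq
    with Fin.combine-injective (source e) (target e) (source e′) (target e′) (g-inj eq)
  ... | s≡ , t≡ = cong (λ e → subdividing e zero) (Edge-≡ s≡ t≡)

  link : ∀ {x y} → Link x y → Adjacent G (φ x) (φ y)
  link (first e _ _)           = fg _ _
  link (last e _ _)            = Adjacent-sym G (fg _ _)
  link (next e zero zero ())

  hom : ∀ {x y} → SubAdjacent (complete m) (λ _ → 1) x y → Adjacent G (φ x) (φ y)
  hom (fwd xy) = link xy
  hom (bwd yx) = Adjacent-sym G (link yx)

Biclique-⊆ : ∀ {G a b a′ b′} → a ≤ a′ → b ≤ b′ → Biclique a′ b′ G → Biclique a b G
Biclique-⊆ a≤ b≤ (f , g , f-inj , g-inj , fg) =
  (λ i → f (inject≤ i a≤)) , (λ j → g (inject≤ j b≤)) ,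
  (λ eq → Fin.inject≤-injective a≤ a≤ _ _ (f-inj eq)) ,
  (λ eq → Fin.inject≤-injective b≤ b≤ _ _ (g-inj eq)) , λ i j → fg _ _

Biclique-induced : ∀ {G a b} X → Biclique a b (induced G X) → Biclique a b G
Biclique-induced {G} X (f , g , f-inj , g-inj , fg) =
  vertex G X ∘ f , vertex G X ∘ g , f-inj ∘ vertex-injective G X , g-inj ∘ vertex-injective G X , fg

-- Colour bounds for the pieces and the class

-- Large enough for a 1-subdivided clique on w + 1 vertices; the added 2 ensures that singleton
-- parts are small.
bicliqueOrder : ℕ → ℕ
bicliqueOrder w = 2 + suc w * suc w

centredColours : (p d w : ℕ) → ℕ
centredColours 1 d w = properColours d (suc w)
centredColours p d w = sparseColours p d (bicliqueOrder w)

-- For p ≥ 2 a large biclique contains the 1-subdivision of a large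
-- clique, whereas 1-subdivisions are not available when p = 1.
centredPiece : ∀ p {G d w} → IsClassCliqueNumber (TM p G) w → ∀ Y →
  ContractionSequence d (fromGraph (induced G Y)) →
  CentredColouring (suc p) (induced G Y) (centredColours (suc p) d w)
centredPiece zero {G} {d} {w} bound Y seq = proper⇒centred (induced G Y) (proj₁ colouring)
  (proj₂ colouring no-clique ∈⊤ ∈⊤)
  where
  colouring = properColouring (induced G Y) seq (suc w) ⊤

  no-clique : ¬ Clique (induced G Y) ⊤ (suc w)
  no-clique (f , _ , f-adj) =
    n≮n w (TM-complete-bound {G = G} bound (clique⇒TM {G = G} (vertex G Y ∘ f) f-adj))
centredPiece (suc p) {G} {d} {w} bound Y seq =
  sparse⇒centred (suc (suc p)) (induced G Y) {s = bicliqueOrder w} (s≤s (s≤s z≤n)) no-biclique seq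
  where
  no-biclique : ¬ Biclique (bicliqueOrder w) (bicliqueOrder w) (induced G Y)
  no-biclique biclique = n≮n w (TM-complete-bound {G = G} bound (biclique⇒TM {G = G} (s≤s z≤n)
    (Biclique-⊆ {G = G} (≤-trans (m≤m*n (suc w) (suc w)) (m≤n+m _ 2)) (m≤n+m _ 2)
      (Biclique-induced {G} Y biclique))))

proposition4 : ∀ {ℓ} (𝒞 : Pred Graph ℓ) → LowTwinWidthCovers 𝒞 →
    ∀ (p : ℕ) → .{{NonZero p}} → Weaklyχ-Bounded p 𝒞
proposition4 𝒞 covered zero    = ⊥-elim (≢-nonZero⁻¹ 0 refl)
proposition4 𝒞 covered (suc p) with covered (suc p)
-- The successor adds the colour for vertices outside a piece; the exponent bounds the number of
-- pieces.
... | C , N , cover = (λ w → suc (centredColours (suc p) C w) ^ N) , bounded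
  where
  bounded : ∀ G → 𝒞 G → ∀ w c → IsClassCliqueNumber (TM p G) w → Isχ (suc p) G c →
            c ≤ suc (centredColours (suc p) C w) ^ N
  bounded G G∈𝒞 w c bound (_ , minimal) with cover G G∈𝒞
  ... | F , F≤N , covers , tww = ≤-trans
    -- The double negation on the product colouring disappears here, as `c ≤ _` is decidable.
    (decidable-stable (c ≤? _) λ c≰ → lowTreeDepth λ low → c≰ (minimal _ (product , low)))
    (^-monoʳ-≤ (suc (centredColours (suc p) C w)) F≤N)
    where
    colourings : All (λ Y → CentredColouring (suc p) (induced G Y) (centredColours (suc p) C w)) F
    colourings = All.map (λ { {Y} (k , (seq , _) , k≤C) →
      centredPiece p {G} bound Y (ContractionSequence-mono k≤C seq) }) tww

    open ProductColouring G F covers colourings
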